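{- Let $G$ be a graph on $n$ vertices and $k$ a positive integer, and suppose the list of all automorphisms of $G$ is given as input. Then $L(G,k)$ can be computed in $O\big(n^2\log^2 k+2^{|\mathrm{Aut}(G)|}(n\,|\mathrm{Aut}(G)|+n\log k)\big)$ time. In particular, if $|\mathrm{Aut}(G)|=O(\log n)$, then $L(G,k)$ can be computed in time polynomial in $n$ and $\log k$.
   Context: A $k$-labeling of $G$ is a map $\phi:V(G)\to\{1,\dots,k\}$; an automorphism $\pi$ preserves $\phi$ if $\phi(\pi(v))=\phi(v)$ for all $v$; $\phi$ is distinguishing if only the identity preserves it; $L(G,k)$ is the number of distinguishing $k$-labelings of $G$. Running times are measured assuming that an addition of two integers of at most $n\log k$ bits costs $O(n\log k)$ time and a multiplication costs $O(n^2\log^2 k)$ time. -}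

module Defs where

open import Data.Bool.Base using (Bool; true; false; not; _∧_; if_then_else_)
open import Data.Fin.Base using (Fin; toℕ; finToFun; funToFin)
open import Data.Fin.Permutation as Perm using (Permutation′; permutation; _⟨$⟩ʳ_; _⟨$⟩ˡ_; _≈_; inverseˡ; inverseʳ)
open import Data.Fin.Properties as Fin using (all?; finToFun-funToFin)
open import Data.Integer.Base as ℤ using (ℤ; +_; ∣_∣)
open import Data.List.Base using (List; []; _∷_; length; map; filter; allFin; tabulate)
open import Data.List.Relation.Unary.All using (All)
open import Data.List.Relation.Unary.AllPairs using (AllPairs)
open import Data.List.Relation.Unary.Any using (Any)
open import Data.Nat.Base using (ℕ; zero; suc; pred; _+_; _*_; _^_; _⊔_; _≤_; _≤ᵇ_; _≡ᵇ_)
open import Data.Nat.Logarithm using (⌊log₂_⌋)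
open import Data.Product.Base using (_×_; ∃-syntax)
open import Relation.Binary.PropositionalEquality using (_≡_; sym; trans; cong; cong₂)
open import Relation.Nullary using (¬_; Dec)
open import Relation.Nullary.Decidable using (map′; _→-dec_)
import Data.Bool.Properties as Bool

------------------------------------------------------------------------
-- Graphs, automorphisms, distinguishing labelings

record Graph (n : ℕ) : Set where
  field
    adj        : Fin n → Fin n → Bool
    adj-sym    : ∀ u v → adj u v ≡ adj v u
    adj-irrefl : ∀ v → adj v v ≡ false

open Graph public

IsAutomorphism : ∀ {n} → Graph n → Permutation′ n → Set
IsAutomorphism G π = ∀ u v → adj G (π ⟨$⟩ʳ u) (π ⟨$⟩ʳ v) ≡ adj G u v

-- The k labels are the elements of Fin k.
Labeling : ℕ → ℕ → Set
Labeling n k = Fin n → Fin k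

Preserves : ∀ {n k} → Permutation′ n → Labeling n k → Set
Preserves π φ = ∀ v → φ (π ⟨$⟩ʳ v) ≡ φ v

Distinguishing : ∀ {n k} → Graph n → Labeling n k → Set
Distinguishing {n} G φ =
  ∀ (π : Permutation′ n) → IsAutomorphism G π → Preserves π φ → π ≈ Perm.id

-- Decided by running over all pairs (f , g) of mutually inverse maps.
distinguishing? : ∀ {n k} (G : Graph n) (φ : Labeling n k) → Dec (Distinguishing G φ)
distinguishing? {n} {k} G φ =
  map′ to from (all? λ i → all? λ j → test? (finToFun i) (finToFun j))
  where
  Test : (f g : Fin n → Fin n) → Set
  Test f g =
    (∀ v → f (g v) ≡ v) → (∀ v → g (f v) ≡ v) →
    (∀ u v → adj G (f u) (f v) ≡ adj G u v) →
    (∀ v → φ (f v) ≡ φ v) → ∀ v → f v ≡ v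

  test? : ∀ f g → Dec (Test f g)
  test? f g =
    all? (λ v → f (g v) Fin.≟ v) →-dec all? (λ v → g (f v) Fin.≟ v) →-dec
    all? (λ u → all? λ v → adj G (f u) (f v) Bool.≟ adj G u v) →-dec
    all? (λ v → φ (f v) Fin.≟ φ v) →-dec all? (λ v → f v Fin.≟ v)

  to : (∀ i j → Test (finToFun i) (finToFun j)) → Distinguishing G φ
  to h π aut pres v = trans (sym (≗f v))
    (h (funToFin f) (funToFin g)
      (λ w → trans (≗f _) (trans (cong f (≗g w)) (inverseʳ π)))
      (λ w → trans (≗g _) (trans (cong g (≗f w)) (inverseˡ π)))
      (λ u w → trans (cong₂ (adj G) (≗f u) (≗f w)) (aut u w))
      (λ w → trans (cong φ (≗f w)) (pres w))
      v)
    where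
    f g : Fin n → Fin n
    f = π ⟨$⟩ʳ_
    g = π ⟨$⟩ˡ_
    ≗f : ∀ w → finToFun (funToFin f) w ≡ f w
    ≗f = finToFun-funToFin f
    ≗g : ∀ w → finToFun (funToFin g) w ≡ g w
    ≗g = finToFun-funToFin g

  from : Distinguishing G φ → ∀ i j → Test (finToFun i) (finToFun j)
  from d i j fg gf aut pres = d (permutation (finToFun i) (finToFun j) fg gf) aut pres

-- finToFun is a bijection (up to pointwise equality), so every labeling
-- occurs exactly once.
labelings : ∀ n k → List (Labeling n k)
labelings n k = map finToFun (allFin (k ^ n))

L : ∀ {n} → Graph n → ℕ → ℕ
L {n} G k = length (filter (distinguishing? G) (labelings n k))

-- A complete repetition-free list of Aut(G), in any order; |Aut(G)| is its length.
record ListsAut {n} (G : Graph n) (πs : List (Permutation′ n)) : Set where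
  field
    sound    : All (IsAutomorphism G) πs
    complete : ∀ π → IsAutomorphism G π → Any (π ≈_) πs
    distinct : AllPairs (λ π ρ → ¬ (π ≈ ρ)) πs

------------------------------------------------------------------------
-- Model of computation: a random access machine, programmed in a structured
-- language, with two sorts of data.
--
--  * Words (vertex names, counters, array indices): unit cost.  The only
--    arithmetic is successor and predecessor, so in time t no word exceeds
--    (largest input word or program literal) + t, and unit cost cannot be
--    used to do arithmetic on long integers.
--  * Integers of arbitrary length, charged by bit length: linear for reading,
--    comparison, addition and subtraction, quadratic for multiplication.
--
-- Each sort has scalar variables and zero-initialised arrays (two-dimensional
-- for words), identified by fixed numbers in the program text.

infixl 6 _⊕_ _⊖_
infixl 7 _⊗_
infix  4 _≤ʷ_ _≤ᶻ_
infixr 3 _andᵇ_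
infix  2 _≔ʷ_ _[_,_]≔ʷ_ _≔ᶻ_ _[_]≔ᶻ_
infixr 1 _⨾_

data WExp : Set where
  lit  : ℕ → WExp
  var  : ℕ → WExp
  cell : ℕ → WExp → WExp → WExp
  succ : WExp → WExp
  pre  : WExp → WExp

data ZExp : Set where
  lit          : ℤ → ZExp
  var          : ℕ → ZExp
  cell         : ℕ → WExp → ZExp
  _⊕_ _⊖_ _⊗_ : ZExp → ZExp → ZExp

data BExp : Set where
  _≤ʷ_  : WExp → WExp → BExp
  _≤ᶻ_  : ZExp → ZExp → BExp
  notᵇ  : BExp → BExp
  _andᵇ_ : BExp → BExp → BExp

data Program : Set where
  skip         : Program
  _≔ʷ_         : ℕ → WExp → Program
  _[_,_]≔ʷ_    : ℕ → WExp → WExp → WExp → Program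
  _≔ᶻ_         : ℕ → ZExp → Program
  _[_]≔ᶻ_      : ℕ → WExp → ZExp → Program
  _⨾_          : Program → Program → Program
  ite          : BExp → Program → Program → Program
  while        : BExp → Program → Program

record State : Set where
  constructor state
  field
    wvar : ℕ → ℕ
    warr : ℕ → ℕ → ℕ → ℕ
    zvar : ℕ → ℤ
    zarr : ℕ → ℕ → ℤ

open State public

infixl 9 _[_↦_]

_[_↦_] : ∀ {A : Set} → (ℕ → A) → ℕ → A → (ℕ → A)
(f [ i ↦ a ]) j = if i ≡ᵇ j then a else f j

setWVar : ℕ → ℕ → State → State
setWVar x a s = record s { wvar = wvar s [ x ↦ a ] }

setWArr : ℕ → ℕ → ℕ → ℕ → State → State
setWArr x i j a s =
  record s { warr = warr s [ x ↦ warr s x [ i ↦ warr s x i [ j ↦ a ] ] ] }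

setZVar : ℕ → ℤ → State → State
setZVar x a s = record s { zvar = zvar s [ x ↦ a ] }

setZArr : ℕ → ℕ → ℤ → State → State
setZArr x i a s = record s { zarr = zarr s [ x ↦ zarr s x [ i ↦ a ] ] }

⟦_⟧ʷ : WExp → State → ℕ
⟦ lit a ⟧ʷ      s = a
⟦ var x ⟧ʷ      s = wvar s x
⟦ cell x d e ⟧ʷ s = warr s x (⟦ d ⟧ʷ s) (⟦ e ⟧ʷ s)
⟦ succ e ⟧ʷ     s = suc (⟦ e ⟧ʷ s)
⟦ pre e ⟧ʷ      s = pred (⟦ e ⟧ʷ s)

⟦_⟧ᶻ : ZExp → State → ℤ
⟦ lit a ⟧ᶻ    s = a
⟦ var x ⟧ᶻ    s = zvar s x
⟦ cell x e ⟧ᶻ s = zarr s x (⟦ e ⟧ʷ s)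
⟦ d ⊕ e ⟧ᶻ    s = ⟦ d ⟧ᶻ s ℤ.+ ⟦ e ⟧ᶻ s
⟦ d ⊖ e ⟧ᶻ    s = ⟦ d ⟧ᶻ s ℤ.- ⟦ e ⟧ᶻ s
⟦ d ⊗ e ⟧ᶻ    s = ⟦ d ⟧ᶻ s ℤ.* ⟦ e ⟧ᶻ s

⟦_⟧ᵇ : BExp → State → Bool
⟦ d ≤ʷ e ⟧ᵇ   s = ⟦ d ⟧ʷ s ≤ᵇ ⟦ e ⟧ʷ s
⟦ d ≤ᶻ e ⟧ᵇ   s = ⟦ d ⟧ᶻ s ℤ.≤ᵇ ⟦ e ⟧ᶻ s
⟦ notᵇ b ⟧ᵇ   s = not (⟦ b ⟧ᵇ s)
⟦ b andᵇ c ⟧ᵇ s = ⟦ b ⟧ᵇ s ∧ ⟦ c ⟧ᵇ s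

-- Number of binary digits of ∣ a ∣ (1 for a = 0, as ⌊log₂ 0 ⌋ = 0).
bits : ℤ → ℕ
bits a = suc ⌊log₂ ∣ a ∣ ⌋

maxBits : ℤ → ℤ → ℕ
maxBits a b = bits a ⊔ bits b

costʷ : WExp → ℕ
costʷ (lit a)      = 1
costʷ (var x)      = 1
costʷ (cell x d e) = 1 + costʷ d + costʷ e
costʷ (succ e)     = 1 + costʷ e
costʷ (pre e)      = 1 + costʷ e

costᶻ : ZExp → State → ℕ
costᶻ (lit a)    s = bits a
costᶻ (var x)    s = bits (zvar s x)
costᶻ (cell x e) s = costʷ e + bits (⟦ cell x e ⟧ᶻ s)
costᶻ (d ⊕ e)    s = costᶻ d s + costᶻ e s + maxBits (⟦ d ⟧ᶻ s) (⟦ e ⟧ᶻ s)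
costᶻ (d ⊖ e)    s = costᶻ d s + costᶻ e s + maxBits (⟦ d ⟧ᶻ s) (⟦ e ⟧ᶻ s)
costᶻ (d ⊗ e)    s = costᶻ d s + costᶻ e s + maxBits (⟦ d ⟧ᶻ s) (⟦ e ⟧ᶻ s) ^ 2

costᵇ : BExp → State → ℕ
costᵇ (d ≤ʷ e)   s = 1 + costʷ d + costʷ e
costᵇ (d ≤ᶻ e)   s = costᶻ d s + costᶻ e s + maxBits (⟦ d ⟧ᶻ s) (⟦ e ⟧ᶻ s)
costᵇ (notᵇ b)   s = 1 + costᵇ b s
costᵇ (b andᵇ c) s = 1 + costᵇ b s + costᵇ c s

-- ⟨ P , s ⟩⇓⟨ s′ , t ⟩: P started in s halts in s′ after time t.
data ⟨_,_⟩⇓⟨_,_⟩ : Program → State → State → ℕ → Set where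

  skip⇓ : ∀ {s} → ⟨ skip , s ⟩⇓⟨ s , 1 ⟩

  ≔ʷ⇓ : ∀ {s x e} →
    ⟨ x ≔ʷ e , s ⟩⇓⟨ setWVar x (⟦ e ⟧ʷ s) s , 1 + costʷ e ⟩

  []≔ʷ⇓ : ∀ {s x c d e} →
    ⟨ x [ c , d ]≔ʷ e , s ⟩⇓⟨ setWArr x (⟦ c ⟧ʷ s) (⟦ d ⟧ʷ s) (⟦ e ⟧ʷ s) s
                            , 1 + costʷ c + costʷ d + costʷ e ⟩

  ≔ᶻ⇓ : ∀ {s x e} →
    ⟨ x ≔ᶻ e , s ⟩⇓⟨ setZVar x (⟦ e ⟧ᶻ s) s , 1 + costᶻ e s ⟩

  []≔ᶻ⇓ : ∀ {s x d e} →
    ⟨ x [ d ]≔ᶻ e , s ⟩⇓⟨ setZArr x (⟦ d ⟧ʷ s) (⟦ e ⟧ᶻ s) s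
                        , 1 + costʷ d + costᶻ e s ⟩

  ⨾⇓ : ∀ {P Q s s′ s″ t u} →
    ⟨ P , s ⟩⇓⟨ s′ , t ⟩ → ⟨ Q , s′ ⟩⇓⟨ s″ , u ⟩ →
    ⟨ P ⨾ Q , s ⟩⇓⟨ s″ , t + u ⟩

  if-true⇓ : ∀ {b P Q s s′ t} → ⟦ b ⟧ᵇ s ≡ true →
    ⟨ P , s ⟩⇓⟨ s′ , t ⟩ →
    ⟨ ite b P Q , s ⟩⇓⟨ s′ , 1 + costᵇ b s + t ⟩

  if-false⇓ : ∀ {b P Q s s′ t} → ⟦ b ⟧ᵇ s ≡ false →
    ⟨ Q , s ⟩⇓⟨ s′ , t ⟩ →
    ⟨ ite b P Q , s ⟩⇓⟨ s′ , 1 + costᵇ b s + t ⟩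

  while-true⇓ : ∀ {b P s s′ s″ t u} → ⟦ b ⟧ᵇ s ≡ true →
    ⟨ P , s ⟩⇓⟨ s′ , t ⟩ → ⟨ while b P , s′ ⟩⇓⟨ s″ , u ⟩ →
    ⟨ while b P , s ⟩⇓⟨ s″ , 1 + costᵇ b s + t + u ⟩

  while-false⇓ : ∀ {b P s} → ⟦ b ⟧ᵇ s ≡ false →
    ⟨ while b P , s ⟩⇓⟨ s , 1 + costᵇ b s ⟩

------------------------------------------------------------------------
-- Input and output conventions

entry : ∀ {A : Set} → A → List A → ℕ → A
entry d []       i       = d
entry d (x ∷ xs) zero    = x
entry d (x ∷ xs) (suc i) = entry d xs i

-- The contents of the array with the given rows; 0 outside.
matrix : List (List ℕ) → ℕ → ℕ → ℕ
matrix rows i j = entry 0 (entry [] rows i) j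

adjacencyMatrix : ∀ {n} → Graph n → List (List ℕ)
adjacencyMatrix G = tabulate λ u → tabulate λ v → if adj G u v then 1 else 0

oneLine : ∀ {n} → Permutation′ n → List ℕ
oneLine π = tabulate λ v → toℕ (π ⟨$⟩ʳ v)

-- Word variables 0 and 1 hold n and the number of listed permutations, word
-- arrays 0 and 1 the adjacency matrix and the table (i , v) ↦ πᵢ(v), and
-- integer variable 0 holds k.
input : ∀ {n} → Graph n → ℕ → List (Permutation′ n) → State
input {n} G k πs = state
  ((λ _ → 0) [ 0 ↦ n ] [ 1 ↦ length πs ])
  ((λ _ _ _ → 0) [ 0 ↦ matrix (adjacencyMatrix G) ] [ 1 ↦ matrix (map oneLine πs) ])
  ((λ _ → + 0) [ 0 ↦ + k ])
  (λ _ _ → + 0)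

output : State → ℤ
output s = zvar s 0

------------------------------------------------------------------------
-- Computing L(G,k) within a time bound

GraphClass : Set₁
GraphClass = ∀ {n} → Graph n → Set

-- On the graphs of 𝒢 with n ≥ 1 vertices, all k ≥ 1, and every listing of
-- Aut(G), P outputs L(G,k) within time f n k |Aut(G)|.
ComputesLWithin : Program → GraphClass → (ℕ → ℕ → ℕ → ℕ) → Set
ComputesLWithin P 𝒢 f =
  ∀ {n} (G : Graph n) (k : ℕ) (πs : List (Permutation′ n)) →
  1 ≤ n → 1 ≤ k → 𝒢 G → ListsAut G πs →
  ∃[ s ] ∃[ t ] (⟨ P , input G k πs ⟩⇓⟨ s , t ⟩
               × output s ≡ + L G k
               × t ≤ f n k (length πs))

-- |Aut(G)| = O(log n) for G in 𝒢.
HasLogAut : GraphClass → Set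
HasLogAut 𝒢 =
  ∃[ c ] ∃[ N ] (∀ {n} (G : Graph n) (πs : List (Permutation′ n)) →
                 N ≤ n → 𝒢 G → ListsAut G πs → length πs ≤ c * ⌊log₂ n ⌋)

{-# OPTIONS --safe #-}
module Submission where

-- By inclusion–exclusion over the sets S of non-identity automorphisms,
-- L(G,k) = Σ_S (-1)^|S| k^(c S), where c S is the number of components of the
-- graph joining v to π v for all π in S.  The program runs a binary counter
-- through the 2^b sets, finds c S by a graph search in time O(n b), and adds or
-- subtracts a power of k of O(n log k) bits.  The table of all powers of k must
-- not cost n multiplications of n log k bits each: multiplying by k by
-- shift-and-add takes O(log k) additions, hence n² log² k in total.

open import Defs
open import Data.Bool.Base using (Bool; true; false; not; _∧_; _xor_; if_then_else_; T)
open import Data.Bool.Properties using (xor-assoc; xor-comm; xor-identityʳ)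
open import Data.Fin.Base as Fin using (Fin; toℕ; fromℕ<; finToFun; funToFin; combine)
open import Data.Fin.Permutation as Perm using (Permutation′; _⟨$⟩ʳ_; _⟨$⟩ˡ_; inverseˡ)
open import Data.Fin.Properties using (all?; toℕ<n; toℕ-fromℕ<; fromℕ<-toℕ; toℕ-injective; pigeonhole; finToFun-funToFin; funToFin-finToFin)
open import Data.Integer.Base as ℤ using (ℤ; +_; ∣_∣)
open import Data.Integer.Solver using (module +-*-Solver)
open import Data.List.Base using (List; []; _∷_; _++_; length; map; filter; tabulate; allFin; lookup)
open import Data.List.Membership.Propositional using (_∈_; find)
open import Data.List.Membership.Propositional.Properties using (∈-filter⁺; ∈-filter⁻; ∈-map⁺; ∈-map⁻; ∈-allFin; ∈-lookup)
open import Data.List.Membership.Propositional.Properties.WithK using (unique∧set⇒bag)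
open import Data.List.Properties using (filter-++; ++-assoc; length-++; ++-identityʳ; filter-accept; filter-reject; filter-≐; length-filter; length-map; length-tabulate)
open import Data.List.Relation.Binary.BagAndSetEquality using (∼bag⇒↭)
open import Data.List.Relation.Binary.Permutation.Propositional.Properties using (↭-length)
open import Data.List.Relation.Unary.All as All using (All; []; _∷_)
open import Data.List.Relation.Unary.AllPairs using (AllPairs; []; _∷_)
open import Data.List.Relation.Unary.Any using (here; there)
open import Data.Nat.Base
open import Data.Nat.GeneralisedArithmetic using (fold)
open import Data.Nat.Logarithm using (⌊log₂_⌋; ⌊log₂⌋-mono-≤; ⌊log₂[2^n]⌋≡n; ⌊log₂⌊n/2⌋⌋≡⌊log₂n⌋∸1)
open import Data.Nat.Properties
open import Data.Nat.Tactic.RingSolver using (solve-∀)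
open import Data.Product.Base using (_×_; _,_; ∃-syntax; proj₁; proj₂)
open import Data.Sum.Base using (_⊎_; inj₁; inj₂)
open import Data.Unit.Base using (⊤; tt)
open import Data.Vec.Base using (Vec; []; _∷_; replicate)
open import Function.Base using (_∘_; id)
open import Function.Bundles using (mk⇔)
open import Relation.Binary.PropositionalEquality using (_≡_; _≢_; _≗_; ≢-sym; refl; sym; trans; cong; cong₂; subst; subst₂; module ≡-Reasoning)
open import Relation.Nullary using (¬_; Dec; yes; no; contradiction)
open import Relation.Nullary.Decidable using (True; toWitness; ¬?; _×-dec_)
open import Relation.Unary using (Decidable; _∩_)
import Data.Fin.Properties as Finₚ
import Data.Integer.Properties as ℤ
import Data.List.Relation.Unary.Unique.Propositional.Properties as Unique

-- Timed Hoare triples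

-- `k ^ c` is the number of labelings preserved by all of S: they are the ones constant on each
-- component. The identity has to be left out, since it preserves every labeling. The machine shapes
-- the algorithm. Words have only successor and predecessor, so parity is a table lookup and the
-- component count serves directly as an index into the table of powers. Only images under the
-- listed automorphisms are tabulated, so the search follows edges in one direction and finiteness
-- has to supply the other. Partial sums have at most 2^b terms of size at most k^n, hence b + O(n
-- log k) bits, which a round that already costs n b can afford. The delicate case of the time bound
-- is k = 1, where log k = 0 and the bound contains no term n². Bit lengths must therefore be
-- estimated by multiples of n log k, with nothing added that grows with n. Each triple below
-- carries termination, correctness and an explicit time bound together; the bounds stay exact
-- polynomials until the very end.

record Run (P : Program) (s : State) (T : ℕ) (Q : State → Set) : Set where
  constructor run
  field
    {final}  : State
    {time}   : ℕ
    exec     : ⟨ P , s ⟩⇓⟨ final , time ⟩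
    post     : Q final
    within   : time ≤ T

infixr 1 _>>_

slower : ∀ {P s T U Q} → T ≤ U → Run P s T Q → Run P s U Q
slower T≤U (run e q t≤T) = run e q (≤-trans t≤T T≤U)

-- For straight-line code both bounds are numerals, so the comparison is decided by evaluation and
-- leaves no proof obligation.
at-most : ∀ U {P s T Q} {_ : True (T ≤? U)} → Run P s T Q → Run P s U Q
at-most U {_} {_} {_} {_} {T≤U} = slower (toWitness T≤U)

weaken : ∀ {P s T Q R} → (∀ {s′} → Q s′ → R s′) → Run P s T Q → Run P s T R
weaken f (run e q t≤T) = run e (f q) t≤T

result : ∀ {P s T U Q} → Run P s T Q → T ≤ U →
         ∃[ s′ ] ∃[ t ] (⟨ P , s ⟩⇓⟨ s′ , t ⟩ × Q s′ × t ≤ U)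
result (run e q t≤T) T≤U = _ , _ , e , q , ≤-trans t≤T T≤U

_>>_ : ∀ {P R s T U Q S} → Run P s T Q → (∀ {s′} → Q s′ → Run R s′ U S) →
       Run (P ⨾ R) s (T + U) S
run e q t≤T >> f with run e′ q′ u≤U ← f q = run (⨾⇓ e e′) q′ (+-mono-≤ t≤T u≤U)

done : ∀ {s Q} → Q s → Run skip s 1 Q
done q = run skip⇓ q ≤-refl

setʷ : ∀ {x e s Q} → Q (setWVar x (⟦ e ⟧ʷ s) s) → Run (x ≔ʷ e) s (1 + costʷ e) Q
setʷ q = run ≔ʷ⇓ q ≤-refl

setʷ[] : ∀ {x c d e s Q} → Q (setWArr x (⟦ c ⟧ʷ s) (⟦ d ⟧ʷ s) (⟦ e ⟧ʷ s) s) →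
         Run (x [ c , d ]≔ʷ e) s (1 + costʷ c + costʷ d + costʷ e) Q
setʷ[] q = run []≔ʷ⇓ q ≤-refl

-- Word costs can be read off the syntax, but the cost of an integer expression depends on the
-- values in the state. Hence the bound `c`.
setᶻ : ∀ {x e s c Q} → costᶻ e s ≤ c → Q (setZVar x (⟦ e ⟧ᶻ s) s) → Run (x ≔ᶻ e) s (1 + c) Q
setᶻ e≤c q = run ≔ᶻ⇓ q (s≤s e≤c)

setᶻ[] : ∀ {x d e s c Q} → costᶻ e s ≤ c → Q (setZArr x (⟦ d ⟧ʷ s) (⟦ e ⟧ᶻ s) s) →
         Run (x [ d ]≔ᶻ e) s (1 + costʷ d + c) Q
setᶻ[] {d = d} e≤c q = run []≔ᶻ⇓ q (+-monoʳ-≤ (1 + costʷ d) e≤c)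

-- The continuation starts in the explicitly updated state, so no intermediate assertion is needed;
-- `>>` passes through an assertion `Q` and forgets the state.
thenʷ : ∀ {x e R s U S} → Run R (setWVar x (⟦ e ⟧ʷ s) s) U S →
        Run (x ≔ʷ e ⨾ R) s (1 + costʷ e + U) S
thenʷ (run e q u≤U) = run (⨾⇓ ≔ʷ⇓ e) q (+-monoʳ-≤ _ u≤U)

thenʷ[] : ∀ {x c d e R s U S} → Run R (setWArr x (⟦ c ⟧ʷ s) (⟦ d ⟧ʷ s) (⟦ e ⟧ʷ s) s) U S →
          Run (x [ c , d ]≔ʷ e ⨾ R) s (1 + costʷ c + costʷ d + costʷ e + U) S
thenʷ[] (run e q u≤U) = run (⨾⇓ []≔ʷ⇓ e) q (+-monoʳ-≤ _ u≤U)

thenᶻ : ∀ {x e R s c U S} → costᶻ e s ≤ c → Run R (setZVar x (⟦ e ⟧ᶻ s) s) U S →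
        Run (x ≔ᶻ e ⨾ R) s (1 + c + U) S
thenᶻ e≤c (run e q u≤U) = run (⨾⇓ ≔ᶻ⇓ e) q (+-mono-≤ (s≤s e≤c) u≤U)

thenᶻ[] : ∀ {x d e R s c U S} → costᶻ e s ≤ c → Run R (setZArr x (⟦ d ⟧ʷ s) (⟦ e ⟧ᶻ s) s) U S →
          Run (x [ d ]≔ᶻ e ⨾ R) s (1 + costʷ d + c + U) S
thenᶻ[] {d = d} e≤c (run e q u≤U) =
  run (⨾⇓ []≔ᶻ⇓ e) q (+-mono-≤ (+-monoʳ-≤ (1 + costʷ d) e≤c) u≤U)

branch : ∀ {b P R s T U Q} → costᵇ b s ≤ U →
         (⟦ b ⟧ᵇ s ≡ true → Run P s T Q) → (⟦ b ⟧ᵇ s ≡ false → Run R s T Q) →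
         Run (ite b P R) s (1 + U + T) Q
branch {b} {s = s} cost yes′ no′ with ⟦ b ⟧ᵇ s in eq
... | true  with run e q t≤T ← yes′ refl = run (if-true⇓ eq e) q (+-mono-≤ (s≤s cost) t≤T)
... | false with run e q t≤T ← no′ refl  = run (if-false⇓ eq e) q (+-mono-≤ (s≤s cost) t≤T)

loop : ∀ {b P T U Q} (I : ℕ → State → Set) →
       (∀ d s → I d s → costᵇ b s ≤ U) →
       (∀ d s → I d s → ⟦ b ⟧ᵇ s ≡ true → ∃[ e ] (d ≡ suc e × Run P s T (I e))) →
       (∀ d s → I d s → ⟦ b ⟧ᵇ s ≡ false → Q s) →
       ∀ d {s} → I d s → Run (while b P) s (d * (1 + U + T) + (1 + U)) Q
loop {b} {P} {T} {U} {Q} I cost step exit = go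
  where
  go : ∀ d {s} → I d s → Run (while b P) s (d * (1 + U + T) + (1 + U)) Q
  go d {s} i with ⟦ b ⟧ᵇ s in eq
  ... | false = run (while-false⇓ eq) (exit _ _ i eq)
                  (≤-trans (s≤s (cost _ _ i)) (m≤n+m (1 + U) (d * (1 + U + T))))
  ... | true with e , refl , run p i′ t≤T ← step _ _ i eq
             with run p′ q u≤ ← go e i′ =
    run (while-true⇓ eq p p′) q
      (≤-trans (+-mono-≤ (+-mono-≤ (s≤s (cost _ _ i)) t≤T) u≤)
               (≤-reflexive (sym (+-assoc (1 + U + T) (e * (1 + U + T)) (1 + U)))))

-- Boolean guards, pointwise updates and counting loops.

≤ᵇ-true : ∀ {m n} → (m ≤ᵇ n) ≡ true → m ≤ n
≤ᵇ-true {m} {n} eq = ≤ᵇ⇒≤ m n (subst T (sym eq) _)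

≤ᵇ-false : ∀ {m n} → (m ≤ᵇ n) ≡ false → n < m
≤ᵇ-false eq = ≰⇒> λ m≤n → subst T eq (≤⇒≤ᵇ m≤n)

not-true : ∀ {b} → not b ≡ true → b ≡ false
not-true {false} _ = refl

not-false : ∀ {b} → not b ≡ false → b ≡ true
not-false {true} _ = refl

∧-true : ∀ {b c} → b ∧ c ≡ true → b ≡ true × c ≡ true
∧-true {true} {true} _ = refl , refl

∧-false : ∀ {b c} → b ∧ c ≡ false → b ≡ false ⊎ c ≡ false
∧-false {false} _ = inj₁ refl
∧-false {true}  c = inj₂ c

≡ᵇ-refl : ∀ i → (i ≡ᵇ i) ≡ true
≡ᵇ-refl zero    = refl
≡ᵇ-refl (suc i) = ≡ᵇ-refl i

≢⇒≡ᵇ-false : ∀ {i j} → i ≢ j → (i ≡ᵇ j) ≡ false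
≢⇒≡ᵇ-false {i} {j} i≢j with i ≡ᵇ j in eq
... | false = refl
... | true  = contradiction (≡ᵇ⇒≡ i j (subst T (sym eq) _)) i≢j

update-same : ∀ {A : Set} (f : ℕ → A) i {a} → (f [ i ↦ a ]) i ≡ a
update-same f i rewrite ≡ᵇ-refl i = refl

update-other : ∀ {A : Set} (f : ℕ → A) {i j a} → i ≢ j → (f [ i ↦ a ]) j ≡ f j
update-other f i≢j rewrite ≢⇒≡ᵇ-false i≢j = refl

for : ℕ → ℕ → Program → Program
for x y P = x ≔ʷ lit 0 ⨾ while (notᵇ (var y ≤ʷ var x)) (P ⨾ x ≔ʷ succ (var x))

-- 2 for the initialisation, 5 for each of the `N + 1` tests, 3 for each increment of the loop
-- variable.
forTime : ℕ → ℕ → ℕ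
forTime N T = 2 + (N * (5 + (T + 3)) + 5)

-- The body establishes the invariant for the state after the increment. With concrete variable
-- numbers the update of `x` then computes away wherever `I` reads something else.
for-run : ∀ {x y P T N s} (I : ℕ → State → Set) → (y ≡ᵇ x) ≡ false → (x ≡ᵇ y) ≡ false →
          (∀ i s → i < N → wvar s x ≡ i → wvar s y ≡ N → I i s →
             Run P s T (λ s′ → wvar s′ x ≡ i × wvar s′ y ≡ N × I (suc i) (setWVar x (suc i) s′))) →
          wvar s y ≡ N → I 0 (setWVar x 0 s) →
          Run (for x y P) s (forTime N T) (λ s′ → wvar s′ y ≡ N × I N s′)
for-run {x} {y} {P} {T} {N} {s} I y≢x x≢y step ys i₀ =
  setʷ {Q = J N} (0 , refl , update-same (wvar s) x , trans (cong (if_then 0 else wvar s y) x≢y) ys , i₀)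
  >> loop J (λ _ _ _ → ≤-refl) body exit N
  where
  J : ℕ → State → Set
  J d s = ∃[ i ] (i + d ≡ N × wvar s x ≡ i × wvar s y ≡ N × I i s)

  body : ∀ d s → J d s → ⟦ notᵇ (var y ≤ʷ var x) ⟧ᵇ s ≡ true →
         ∃[ e ] (d ≡ suc e × Run (P ⨾ x ≔ʷ succ (var x)) s (T + 3) (J e))
  body zero s (i , i≡N , xs , ys , inv) g =
    contradiction (trans xs (trans (sym (+-identityʳ i)) (trans i≡N (sym ys))))
                  (<⇒≢ (≤ᵇ-false (not-true {wvar s y ≤ᵇ wvar s x} g)))
  body (suc e) _ (i , i+d≡N , xs , ys , inv) g = e , refl ,
    (step _ _ (≤-trans (m≤m+n (suc i) e) (≤-reflexive (trans (sym (+-suc i e)) i+d≡N))) xs ys inv >>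
     λ {s′} (xs′ , ys′ , inv′) → setʷ
       ( suc i , trans (sym (+-suc i e)) i+d≡N
       , trans (update-same (wvar s′) x) (cong suc xs′)
       , trans (cong (if_then suc (wvar s′ x) else wvar s′ y) x≢y) ys′
       , subst (λ j → I (suc i) (setWVar x (suc j) s′)) (sym xs′) inv′))

  exit : ∀ d s → J d s → ⟦ notᵇ (var y ≤ʷ var x) ⟧ᵇ s ≡ false → wvar s y ≡ N × I N s
  exit d s (i , i+d≡N , xs , ys , inv) g = ys , subst (λ j → I j s)
    (≤-antisym (≤-trans (m≤m+n i d) (≤-reflexive i+d≡N))
               (≤-trans (≤-reflexive (sym ys))
                 (≤-trans (≤ᵇ-true (not-false {wvar s y ≤ᵇ wvar s x} g)) (≤-reflexive xs))))
    inv

-- Connected components by graph search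

unmarked : (ℕ → ℕ) → ℕ → ℕ
unmarked M zero    = 0
unmarked M (suc n) = (if M n ≡ᵇ 0 then 1 else 0) + unmarked M n

unmarked-update-≥ : ∀ M {w c} n → n ≤ w → unmarked (M [ w ↦ c ]) n ≡ unmarked M n
unmarked-update-≥ M zero    _   = refl
unmarked-update-≥ M (suc n) n<w = cong₂ _+_
  (cong (λ m → if m ≡ᵇ 0 then 1 else 0) (update-other M (≢-sym (<⇒≢ n<w))))
  (unmarked-update-≥ M n (<⇒≤ n<w))

-- A vertex loses its zero mark exactly when it enters the queue. Thus queue length plus `unmarked`
-- stays equal to `n`, which bounds the queue.
unmarked-update : ∀ M {w c} n → w < n → M w ≡ 0 → suc (unmarked (M [ w ↦ suc c ]) n) ≡ unmarked M n
unmarked-update M {w} {c} (suc n) w<1+n Mw≡0 with w ≟ n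
... | yes refl rewrite update-same M w {suc c} | Mw≡0 = cong suc (unmarked-update-≥ M w ≤-refl)
... | no w≢n rewrite update-other M {a = suc c} w≢n = begin
  suc (x + unmarked (M [ w ↦ suc c ]) n) ≡⟨ sym (+-suc x _) ⟩
  x + suc (unmarked (M [ w ↦ suc c ]) n) ≡⟨ cong (λ z → x + z) (unmarked-update M n (≤∧≢⇒< (≤-pred w<1+n) w≢n) Mw≡0) ⟩
  x + unmarked M n ∎
  where
  open ≡-Reasoning
  x = if M n ≡ᵇ 0 then 1 else 0

unmarked-zero : ∀ M n → (∀ {u} → u < n → M u ≡ 0) → unmarked M n ≡ n
unmarked-zero M zero    _ = refl
unmarked-zero M (suc n) z rewrite z {n} ≤-refl = cong suc (unmarked-zero M n (z ∘ m<n⇒m<1+n))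

-- Each row i < b of the table is a permutation of {0,…,n-1}.  Finiteness enters
-- only through "back": a set closed under a row is closed under its inverse.
module GraphSearch (n b : ℕ) (tab : ℕ → ℕ → ℕ) (sel : ℕ → ℕ)
  (tab< : ∀ {i u} → i < b → u < n → tab i u < n)
  (back : ∀ {i} → i < b → (A : ℕ → Set) → (∀ {u} → u < n → A u → A (tab i u)) →
          ∀ {u} → u < n → A (tab i u) → A u)
  where

  Invariant : (ℕ → ℕ) → Set
  Invariant φ = ∀ {i u} → i < b → 1 ≤ sel i → u < n → φ (tab i u) ≡ φ u

  -- Connectedness by duality: no invariant function separates the two vertices. Symmetry and
  -- transitivity come for free, no paths are needed, and a preserved labeling can be plugged in for
  -- `φ` directly.
  Connected : ℕ → ℕ → Set
  Connected u w = ∀ φ → Invariant φ → φ u ≡ φ w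

  -- M assigns component numbers (0: not yet reached), Q lists the reached
  -- vertices, those before h being fully explored.
  record Searching (M Q : ℕ → ℕ) (h t v cnt : ℕ) : Set where
    field
      h≤t     : h ≤ t
      cnt≤t   : cnt ≤ t
      counted : t + unmarked M n ≡ n
      queue<  : ∀ {j} → j < t → Q j < n
      queue-M : ∀ {j} → j < t → 1 ≤ M (Q j)
      queued  : ∀ {u} → u < n → 1 ≤ M u → ∃[ j ] (j < t × Q j ≡ u)
      M≤cnt   : ∀ {u} → u < n → M u ≤ cnt
      -- The queue is emptied before a new root is chosen, so all unexplored vertices belong to the
      -- latest component.
      pending : ∀ {j} → h ≤ j → j < t → M (Q j) ≡ cnt
      closed  : ∀ {j i} → j < h → i < b → 1 ≤ sel i → M (tab i (Q j)) ≡ M (Q j)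
      seen    : ∀ {u} → u < v → 1 ≤ M u
      onto    : ∀ {c} → 1 ≤ c → c ≤ cnt → ∃[ r ] (r < n × M r ≡ c)
      linked  : ∀ {u w} → u < n → w < n → 1 ≤ M u → M u ≡ M w → Connected u w

    t≤n : t ≤ n
    t≤n = ≤-trans (m≤m+n t _) (≤-reflexive counted)

  open Searching

  start : ∀ {M Q} → (∀ {u} → u < n → M u ≡ 0) → Searching M Q 0 0 0 0
  start {M} zeros = record
    { h≤t = z≤n ; cnt≤t = z≤n ; counted = unmarked-zero M n zeros
    ; queue< = λ () ; queue-M = λ ()
    ; queued = λ u<n 1≤M → contradiction (subst (1 ≤_) (zeros u<n) 1≤M) λ ()
    ; M≤cnt = λ u<n → ≤-reflexive (zeros u<n)
    ; pending = λ _ () ; closed = λ () ; seen = λ ()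
    ; onto = λ { (s≤s _) () }
    ; linked = λ u<n _ 1≤M _ → contradiction (subst (1 ≤_) (zeros u<n) 1≤M) λ ()
    }

  -- The component number suc c is cnt if w is reached along an edge, and
  -- cnt + 1 if w is a new root.
  module _ {M Q h t v cnt w c} (S : Searching M Q h t v cnt) (w<n : w < n) (Mw≡0 : M w ≡ 0)
           (cnt≤c : cnt ≤ suc c) where
    private
      M′ Q′ : ℕ → ℕ
      M′ = M [ w ↦ suc c ]
      Q′ = Q [ t ↦ w ]

      w≢ : ∀ {u} → 1 ≤ M u → w ≢ u
      w≢ 1≤M refl = contradiction (subst (1 ≤_) Mw≡0 1≤M) λ ()

      M′-old : ∀ {u} → 1 ≤ M u → M′ u ≡ M u
      M′-old 1≤M = update-other M (w≢ 1≤M)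

      M′-new : M′ w ≡ suc c
      M′-new = update-same M w

      Q′-old : ∀ {j} → j < t → Q′ j ≡ Q j
      Q′-old j<t = update-other Q (≢-sym (<⇒≢ j<t))

      Q′-new : Q′ t ≡ w
      Q′-new = update-same Q t

      M′≥1 : ∀ {u} → 1 ≤ M u → 1 ≤ M′ u
      M′≥1 1≤M = subst (1 ≤_) (sym (M′-old 1≤M)) 1≤M

    reach : ∀ {v′} →
            (∀ {j} → h ≤ j → j < t → cnt ≡ suc c) →
            (∀ {u} → u < v′ → 1 ≤ M u ⊎ w ≡ u) →
            (∀ {c′} → cnt < c′ → c′ ≤ suc c → c′ ≡ suc c) →
            (suc c ≤ suc t) →
            (∀ {u} → u < n → 1 ≤ M u → M u ≡ suc c → Connected u w) →
            Searching M′ Q′ h (suc t) v′ (suc c)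
    reach pend see on cnt≤ link = record
      { h≤t = m≤n⇒m≤1+n (h≤t S)
      ; cnt≤t = cnt≤
      ; counted = trans (sym (+-suc t _)) (trans (cong (λ z → t + z) (unmarked-update M n w<n Mw≡0)) (counted S))
      ; queue< = λ j<1+t → case-last j<1+t (λ q → q < n) (queue< S) w<n
      ; queue-M = λ j<1+t → case-last j<1+t (λ q → 1 ≤ M′ q) (λ j<t → M′≥1 (queue-M S j<t))
                              (subst (1 ≤_) (sym M′-new) (s≤s z≤n))
      ; queued = queued′
      ; M≤cnt = M≤cnt′
      ; pending = λ h≤j j<1+t → case-last j<1+t (λ q → M′ q ≡ suc c)
          (λ j<t → trans (M′-old (queue-M S j<t)) (trans (pending S h≤j j<t) (pend h≤j j<t))) M′-new
      ; closed = λ {j} {i} j<h i<b on′ → let j<t = ≤-trans j<h (h≤t S) in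
          subst (λ q → M′ (tab i q) ≡ M′ q) (sym (Q′-old j<t))
            (trans (M′-old (subst (1 ≤_) (sym (closed S j<h i<b on′)) (queue-M S j<t)))
              (trans (closed S j<h i<b on′) (sym (M′-old (queue-M S j<t)))))
      ; seen = λ u<v′ → seen′ (see u<v′)
      ; onto = onto′
      ; linked = linked′
      }
      where
      case-last : ∀ {j} → j < suc t → (P : ℕ → Set) → (j < t → P (Q j)) → P w → P (Q′ j)
      case-last {j} j<1+t P old new with j ≟ t
      ... | yes refl = subst P (sym Q′-new) new
      ... | no j≢t   = let j<t = ≤∧≢⇒< (≤-pred j<1+t) j≢t in subst P (sym (Q′-old j<t)) (old j<t)

      queued′ : ∀ {u} → u < n → 1 ≤ M′ u → ∃[ j ] (j < suc t × Q′ j ≡ u)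
      queued′ {u} u<n 1≤M′ with w ≟ u
      ... | yes refl = t , ≤-refl , Q′-new
      ... | no w≢u with queued S u<n (subst (1 ≤_) (update-other M w≢u) 1≤M′)
      ... | j , j<t , Qj≡u = j , m<n⇒m<1+n j<t , trans (Q′-old j<t) Qj≡u

      M≤cnt′ : ∀ {u} → u < n → M′ u ≤ suc c
      M≤cnt′ {u} u<n with w ≟ u
      ... | yes refl = ≤-reflexive M′-new
      ... | no w≢u   = ≤-trans (≤-reflexive (update-other M w≢u)) (≤-trans (M≤cnt S u<n) cnt≤c)

      seen′ : ∀ {u} → 1 ≤ M u ⊎ w ≡ u → 1 ≤ M′ u
      seen′ (inj₁ 1≤M)  = M′≥1 1≤M
      seen′ (inj₂ refl) = subst (1 ≤_) (sym M′-new) (s≤s z≤n)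

      onto′ : ∀ {c′} → 1 ≤ c′ → c′ ≤ suc c → ∃[ r ] (r < n × M′ r ≡ c′)
      onto′ {c′} 1≤c′ c′≤ with c′ ≤? cnt
      ... | no c′≰ = w , w<n , trans M′-new (sym (on (≰⇒> c′≰) c′≤))
      ... | yes c′≤cnt with onto S 1≤c′ c′≤cnt
      ... | r , r<n , Mr≡c′ = r , r<n , trans (M′-old (subst (1 ≤_) (sym Mr≡c′) 1≤c′)) Mr≡c′

      linked′ : ∀ {u x} → u < n → x < n → 1 ≤ M′ u → M′ u ≡ M′ x → Connected u x
      linked′ {u} {x} u<n x<n 1≤M′ eq with w ≟ u | w ≟ x
      ... | yes refl | yes refl = λ _ _ → refl
      ... | yes refl | no w≢x   = λ φ inv → sym (link x<n 1≤Mx Mx≡ φ inv)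
        where
        Mx≡ : M x ≡ suc c
        Mx≡ = trans (sym (update-other M w≢x)) (trans (sym eq) M′-new)
        1≤Mx : 1 ≤ M x
        1≤Mx = subst (1 ≤_) (sym Mx≡) (s≤s z≤n)
      ... | no w≢u   | yes refl = link u<n (subst (1 ≤_) (update-other M w≢u) 1≤M′)
                                    (trans (sym (update-other M w≢u)) (trans eq M′-new))
      ... | no w≢u   | no w≢x   = linked S u<n x<n (subst (1 ≤_) (update-other M w≢u) 1≤M′)
                                    (trans (sym (update-other M w≢u)) (trans eq (update-other M w≢x)))

  module _ {M Q h t v cnt} (S : Searching M Q h t v cnt) where

    -- The vertices of earlier components are closed under tab i, hence under its
    -- inverse, so an edge cannot lead from the current component into them.
    reached-same : h < t → ∀ {i} → i < b → 1 ≤ sel i → 1 ≤ M (tab i (Q h)) → M (tab i (Q h)) ≡ M (Q h)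
    reached-same h<t {i} i<b on 1≤M with M (tab i (Q h)) ≟ cnt
    ... | yes eq = trans eq (sym (pending S ≤-refl h<t))
    ... | no neq = contradiction (pending S ≤-refl h<t)
                     (<⇒≢ (proj₂ (back i<b Earlier step (queue< S h<t)
                       (1≤M , ≤∧≢⇒< (M≤cnt S (tab< i<b (queue< S h<t))) neq))))
      where
      Earlier : ℕ → Set
      Earlier u = 1 ≤ M u × M u < cnt
      step : ∀ {u} → u < n → Earlier u → Earlier (tab i u)
      step u<n (1≤Mu , Mu<cnt) with queued S u<n 1≤Mu
      ... | j , j<t , refl with j <? h
      ...   | yes j<h rewrite closed S j<h i<b on = 1≤Mu , Mu<cnt
      ...   | no j≮h = contradiction (pending S (≮⇒≥ j≮h) j<t) (<⇒≢ Mu<cnt)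

    explore : h < t → (∀ {i} → i < b → 1 ≤ sel i → M (tab i (Q h)) ≡ M (Q h)) →
              Searching M Q (suc h) t v cnt
    explore h<t cl = record
      { h≤t = h<t ; cnt≤t = cnt≤t S ; counted = counted S ; queue< = queue< S ; queue-M = queue-M S
      ; queued = queued S ; M≤cnt = M≤cnt S ; pending = λ h<j → pending S (<⇒≤ h<j)
      ; closed = λ {j} {i} j<1+h → closed′ (j ≟ h) j<1+h
      ; seen = seen S ; onto = onto S ; linked = linked S }
      where
      closed′ : ∀ {j i} → Dec (j ≡ h) → j < suc h → i < b → 1 ≤ sel i → M (tab i (Q j)) ≡ M (Q j)
      closed′ (yes refl) _ = cl
      closed′ (no j≢h) j<1+h = closed S (≤∧≢⇒< (≤-pred j<1+h) j≢h)

    advance : 1 ≤ M v → Searching M Q h t (suc v) cnt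
    advance 1≤Mv = record
      { h≤t = h≤t S ; cnt≤t = cnt≤t S ; counted = counted S ; queue< = queue< S ; queue-M = queue-M S
      ; queued = queued S ; M≤cnt = M≤cnt S ; pending = pending S ; closed = closed S
      ; seen = λ {u} u<1+v → seen′ (u ≟ v) u<1+v
      ; onto = onto S ; linked = linked S }
      where
      seen′ : ∀ {u} → Dec (u ≡ v) → u < suc v → 1 ≤ M u
      seen′ (yes refl) _ = 1≤Mv
      seen′ (no u≢v) u<1+v = seen S (≤∧≢⇒< (≤-pred u<1+v) u≢v)

    root : t ≤ h → v < n → M v ≡ 0 →
           Searching (M [ v ↦ suc cnt ]) (Q [ t ↦ v ]) h (suc t) (suc v) (suc cnt)
    root t≤h v<n Mv≡0 = reach S v<n Mv≡0 (n≤1+n cnt)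
      (λ h≤j j<t → contradiction (≤-trans j<t t≤h) (≤⇒≯ h≤j))
      (λ {u} u<1+v → see (u ≟ v) u<1+v)
      (λ cnt<c c≤ → ≤-antisym c≤ cnt<c)
      (s≤s (cnt≤t S))
      (λ u<n _ Mu≡ → contradiction Mu≡ (<⇒≢ (s≤s (M≤cnt S u<n))))
      where
      see : ∀ {u} → Dec (u ≡ v) → u < suc v → 1 ≤ M u ⊎ v ≡ u
      see (yes refl) _ = inj₂ refl
      see (no u≢v) u<1+v = inj₁ (seen S (≤∧≢⇒< (≤-pred u<1+v) u≢v))

    follow : h < t → ∀ {i} → i < b → 1 ≤ sel i → M (tab i (Q h)) ≡ 0 →
             Searching (M [ tab i (Q h) ↦ cnt ]) (Q [ t ↦ tab i (Q h) ]) h (suc t) v cnt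
    follow h<t {i} i<b on Mw≡0 = go cnt refl
      where
      go : ∀ c → cnt ≡ c → Searching (M [ tab i (Q h) ↦ c ]) (Q [ t ↦ tab i (Q h) ]) h (suc t) v c
      -- The vertex under exploration carries the mark `cnt`, which is therefore positive; `reach`
      -- wants it in the form `suc c`.
      go zero eq = contradiction (trans (pending S ≤-refl h<t) eq) (≢-sym (<⇒≢ (queue-M S h<t)))
      go (suc c) refl = reach S (tab< i<b (queue< S h<t)) Mw≡0 ≤-refl
        (λ _ _ → refl)
        (λ u<v → inj₁ (seen S u<v))
        (λ cnt<c c≤ → ≤-antisym c≤ (<⇒≤ cnt<c))
        (m≤n⇒m≤1+n (cnt≤t S))
        (λ u<n 1≤M Mu≡ φ inv →
          trans (linked S u<n (queue< S h<t) 1≤M (trans Mu≡ (sym (pending S ≤-refl h<t))) φ inv)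
                (sym (inv i<b on (queue< S h<t))))

  record Components (M : ℕ → ℕ) (cnt : ℕ) : Set where
    field
      cnt≤n     : cnt ≤ n
      M≥1       : ∀ {u} → u < n → 1 ≤ M u
      M≤        : ∀ {u} → u < n → M u ≤ cnt
      invariant : Invariant M
      surj      : ∀ {c} → 1 ≤ c → c ≤ cnt → ∃[ r ] (r < n × M r ≡ c)
      connected : ∀ {u w} → u < n → w < n → M u ≡ M w → Connected u w

  finished : ∀ {M Q h t v cnt} → Searching M Q h t v cnt → t ≤ h → n ≤ v → Components M cnt
  finished {M} S t≤h n≤v = record
    { cnt≤n = ≤-trans (cnt≤t S) (t≤n S)
    ; M≥1 = all
    ; M≤ = M≤cnt S
    ; invariant = inv
    ; surj = onto S
    ; connected = λ u<n w<n → linked S u<n w<n (all u<n) }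
    where
    all : ∀ {u} → u < n → 1 ≤ M u
    all u<n = seen S (≤-trans u<n n≤v)
    inv : Invariant M
    inv i<b on u<n with queued S u<n (all u<n)
    ... | j , j<t , refl = closed S (≤-trans j<t t≤h) i<b on

-- The program

-- vA automorphisms are given, of which the vB non-identity ones are copied to
-- aTab.  Row 0 of aSel is the current subset S, vS the parity of |S|, and vD
-- becomes 1 after the last subset.  The search explores the queue aQueue from
-- vH to vT, looks for roots at vV, and counts components in vC.  Digits of k
-- are read off with aTwo, whose entry i is 2 ^ i; the first one beyond k is vM.
vN vA vI vB vS vV vH vT vC vU vM vJ vD : ℕ
vN = 0
vA = 1
vI = 2
vB = 3
vS = 4
vV = 5
vH = 6
vT = 7
vC = 8
vU = 9
vM = 10
vJ = 11
vD = 12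

aPerm aTab aSel aMark aQueue aXor : ℕ
aPerm  = 1
aTab   = 2
aSel   = 3
aMark  = 4
aQueue = 5
aXor   = 6

zK zProd zRest zAcc : ℕ
zK    = 0
zProd = 1
zRest = 2
zAcc  = 3

aTwo aPow : ℕ
aTwo = 0
aPow = 1

followEdge exploreNext tryRoot search : Program
followEdge =
  ite (lit 1 ≤ʷ cell aSel (lit 0) (var vI) andᵇ
       cell aMark (lit 0) (cell aTab (var vI) (var vU)) ≤ʷ lit 0)
    (aMark [ lit 0 , cell aTab (var vI) (var vU) ]≔ʷ var vC ⨾
     aQueue [ lit 0 , var vT ]≔ʷ cell aTab (var vI) (var vU) ⨾
     vT ≔ʷ succ (var vT))
    skip
exploreNext =
  vU ≔ʷ cell aQueue (lit 0) (var vH) ⨾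
  for vI vB followEdge ⨾
  vH ≔ʷ succ (var vH)
tryRoot =
  ite (cell aMark (lit 0) (var vV) ≤ʷ lit 0)
    (vC ≔ʷ succ (var vC) ⨾
     aMark [ lit 0 , var vV ]≔ʷ var vC ⨾
     aQueue [ lit 0 , var vT ]≔ʷ var vV ⨾
     vT ≔ʷ succ (var vT))
    skip ⨾
  vV ≔ʷ succ (var vV)
search =
  vH ≔ʷ lit 0 ⨾ vT ≔ʷ lit 0 ⨾ vV ≔ʷ lit 0 ⨾ vC ≔ʷ lit 0 ⨾
  while (notᵇ (var vN ≤ʷ var vV andᵇ var vT ≤ʷ var vH))
    (ite (var vT ≤ʷ var vH) tryRoot exploreNext)

-- Without addition of words, exclusive or is one array access. The table is written as the two
-- updates of a zero array that the program performs.
xorTable : ℕ → ℕ → ℕ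
xorTable = (λ _ _ → 0) [ 0 ↦ (λ _ → 0) [ 1 ↦ 1 ] ] [ 1 ↦ (λ _ → 0) [ 0 ↦ 1 ] ]

record Context′ (n b : ℕ) (tab : ℕ → ℕ → ℕ) (sel : ℕ → ℕ) (pow : ℕ → ℤ) (acc : ℤ)
                (N B D : ℕ) (Tab : ℕ → ℕ → ℕ) (Sel : ℕ → ℕ) (Xor : ℕ → ℕ → ℕ) (Pow : ℕ → ℤ) (Acc : ℤ) : Set where
  constructor context
  field
    vN≡   : N ≡ n
    vB≡   : B ≡ b
    vD≡   : D ≡ 0
    aTab≡ : Tab ≡ tab
    aSel≡ : Sel ≡ sel
    aXor≡ : ∀ i j → Xor i j ≡ xorTable i j
    aPow≡ : Pow ≡ pow
    zAcc≡ : Acc ≡ acc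
open Context′

-- Stated about the projections of s, so that assignments to other variables
-- preserve it definitionally.
Context : (n b : ℕ) (tab : ℕ → ℕ → ℕ) (sel : ℕ → ℕ) (pow : ℕ → ℤ) (acc : ℤ) → State → Set
Context n b tab sel pow acc s = Context′ n b tab sel pow acc
  (wvar s vN) (wvar s vB) (wvar s vD) (warr s aTab) (warr s aSel 0) (warr s aXor) (zarr s aPow) (zvar s zAcc)

-- Every iteration advances either the root candidate `vV` or the queue head `vH`, and neither
-- exceeds `n`: hence `n + n` iterations. The two branches are charged as a sum instead of a
-- maximum.
searchTime : ℕ → ℕ → ℕ
searchTime n b = 8 + ((n + n) * (9 + (4 + (4 + forTime b 30 + 3 + 30))) + 9)

module SearchRun (n b : ℕ) (tab : ℕ → ℕ → ℕ) (sel : ℕ → ℕ)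
  (tab< : ∀ {i u} → i < b → u < n → tab i u < n)
  (back : ∀ {i} → i < b → (A : ℕ → Set) → (∀ {u} → u < n → A u → A (tab i u)) →
          ∀ {u} → u < n → A (tab i u) → A u)
  (pow : ℕ → ℤ) (acc : ℤ) (σ : ℕ)
  where
  open GraphSearch n b tab sel tab< back
  open Searching

  Outer : State → Set
  Outer s = Context n b tab sel pow acc s × wvar s vS ≡ σ

  Search : State → Set
  Search s = Searching (warr s aMark 0) (warr s aQueue 0) (wvar s vH) (wvar s vT) (wvar s vV) (wvar s vC)

  Budget : ℕ → State → Set
  Budget d s = wvar s vV ≤ n × wvar s vV + wvar s vH + d ≡ n + n

  module _ (d x : ℕ) where

    Following : ℕ → State → Set
    Following i s = Outer s × Budget d s × wvar s vU ≡ x × warr s aQueue 0 (wvar s vH) ≡ x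
                  × wvar s vH < wvar s vT × Search s
                  × (∀ {i′} → i′ < i → i′ < b → 1 ≤ sel i′ →
                       warr s aMark 0 (tab i′ x) ≡ warr s aMark 0 x)

    followEdge-run : ∀ i s → i < b → wvar s vI ≡ i → wvar s vB ≡ b → Following i s →
      Run followEdge s 30
        (λ s′ → wvar s′ vI ≡ i × wvar s′ vB ≡ b × Following (suc i) (setWVar vI (suc i) s′))
    followEdge-run i s i<b I≡ B≡ (out , bud , U≡ , Qh≡ , h<t , S , old) =
      at-most 30 (branch ≤-refl
        (λ g → let g₁ , g₂ = ∧-true g in at-most 15 (new (≤ᵇ-true g₁) (n≤0⇒n≡0 (≤ᵇ-true g₂))))
        (λ g → at-most 15 (done (I≡ , B≡ , out , bud , U≡ , Qh≡ , h<t , S ,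
          λ {i′} i′<1+i → skipped (i′ ≟ i) (∧-false g) i′<1+i))))
      where
      M Q : ℕ → ℕ
      M = warr s aMark 0
      Q = warr s aQueue 0
      h t w : ℕ
      h = wvar s vH
      t = wvar s vT
      w = warr s aTab (wvar s vI) (wvar s vU)
      edge : w ≡ tab i x
      edge rewrite I≡ | U≡ = cong (λ f → f i x) (aTab≡ (proj₁ out))
      edge′ : w ≡ tab i (Q h)
      edge′ = trans edge (cong (tab i) (sym Qh≡))
      selᵢ : warr s aSel 0 (wvar s vI) ≡ sel i
      selᵢ rewrite I≡ = cong (λ f → f i) (aSel≡ (proj₁ out))
      1≤Mx : 1 ≤ M x
      1≤Mx = subst (λ y → 1 ≤ M y) Qh≡ (queue-M S h<t)

      skipped : ∀ {i′} → Dec (i′ ≡ i) →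
                ((1 ≤ᵇ warr s aSel 0 (wvar s vI)) ≡ false) ⊎ ((M w ≤ᵇ 0) ≡ false) →
                i′ < suc i → i′ < b → 1 ≤ sel i′ → M (tab i′ x) ≡ M x
      skipped (no i′≢i) _ i′<1+i = old (≤∧≢⇒< (≤-pred i′<1+i) i′≢i)
      skipped (yes refl) (inj₁ off) _ _ on =
        contradiction (subst (1 ≤_) (sym selᵢ) on) (<⇒≱ (≤ᵇ-false off))
      skipped (yes refl) (inj₂ marked) _ _ on =
        subst (λ y → M (tab i y) ≡ M y) Qh≡
          (reached-same S h<t i<b on (subst (λ y → 1 ≤ M y) edge′ (≤ᵇ-false marked)))

      new : 1 ≤ warr s aSel 0 (wvar s vI) → M w ≡ 0 → Run _ s _ _
      new on Mw≡0 = thenʷ[] (thenʷ[] (setʷ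
        ( I≡ , B≡ , out , bud , U≡
        , trans (update-other Q (≢-sym (<⇒≢ h<t))) Qh≡
        , m<n⇒m<1+n h<t
        , S′
        , λ {i′} i′<1+i → cl (i′ ≟ i) i′<1+i)))
        where
        on′ : 1 ≤ sel i
        on′ = subst (1 ≤_) selᵢ on
        M′ : ℕ → ℕ
        M′ = M [ w ↦ wvar s vC ]
        keep : ∀ {u} → 1 ≤ M u → M′ u ≡ M u
        keep 1≤M = update-other M {w} λ { refl → contradiction (subst (1 ≤_) Mw≡0 1≤M) λ () }
        S′ : Searching M′ (Q [ t ↦ w ]) h (suc t) (wvar s vV) (wvar s vC)
        S′ = subst (λ y → Searching (M [ y ↦ wvar s vC ]) (Q [ t ↦ y ]) h (suc t) (wvar s vV) (wvar s vC))
               (sym edge′) (follow S h<t i<b on′ (trans (cong M (sym edge′)) Mw≡0))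
        cl : ∀ {i′} → Dec (i′ ≡ i) → i′ < suc i → i′ < b → 1 ≤ sel i′ → M′ (tab i′ x) ≡ M′ x
        cl (yes refl) _ _ _ = begin
          M′ (tab i x) ≡⟨ cong M′ (sym edge) ⟩
          M′ w         ≡⟨ update-same M w ⟩
          wvar s vC    ≡⟨ sym (pending S ≤-refl h<t) ⟩
          M (Q h)      ≡⟨ cong M Qh≡ ⟩
          M x          ≡⟨ sym (keep 1≤Mx) ⟩
          M′ x         ∎
          where open ≡-Reasoning
        cl (no i′≢i) i′<1+i i′<b on″ =
          let eq = old (≤∧≢⇒< (≤-pred i′<1+i) i′≢i) i′<b on″ in
          trans (keep (subst (1 ≤_) (sym eq) 1≤Mx)) (trans eq (sym (keep 1≤Mx)))

  State-of : ℕ → State → Set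
  State-of d s = Outer s × Budget d s × Search s

  exploreNext-run : ∀ {d s} → wvar s vH < wvar s vT → State-of (suc d) s →
                    Run exploreNext s (4 + forTime b 30 + 3) (State-of d)
  exploreNext-run {d} {s} h<t (out , bud , S) = slower (≤-reflexive (sym (+-assoc 4 (forTime b 30) 3)))
    (thenʷ (for-run (Following (suc d) x) refl refl (followEdge-run (suc d) x) (vB≡ (proj₁ out))
              (out , bud , refl , refl , h<t , S , λ ())
    >> λ {s′} (_ , out′ , bud′ , _ , Qh≡ , h<t′ , S′ , cl) → setʷ
       ( out′
       , (proj₁ bud′ , trans (cong (_+ d) (+-suc (wvar s′ vV) (wvar s′ vH)))
           (trans (sym (+-suc (wvar s′ vV + wvar s′ vH) d)) (proj₂ bud′)))
       , explore S′ h<t′ (λ {i} i<b on →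
           subst (λ y → warr s′ aMark 0 (tab i y) ≡ warr s′ aMark 0 y) (sym Qh≡) (cl i<b i<b on)))))
    where
    x : ℕ
    x = warr s aQueue 0 (wvar s vH)

  tryRoot-run : ∀ {d s} → wvar s vT ≤ wvar s vH → wvar s vV < n → State-of (suc d) s →
                Run tryRoot s 30 (State-of d)
  tryRoot-run {d} {s} t≤h v<n (out , bud , S) = at-most 30
    (branch {Q = λ s′ → State-of d (setWVar vV (suc (wvar s′ vV)) s′)} ≤-refl
       (λ g → at-most 20 (thenʷ (thenʷ[] (thenʷ[] (setʷ
          (out , bud′ , root S t≤h v<n (n≤0⇒n≡0 (≤ᵇ-true g))))))))
       (λ g → at-most 20 (done (out , bud′ , advance S (≤ᵇ-false g))))
     >> setʷ)
    where
    bud′ : Budget d (setWVar vV (suc (wvar s vV)) s)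
    bud′ = v<n , trans (sym (+-suc _ d)) (proj₂ bud)

  search-run : ∀ {s} → Outer s → (∀ {u} → u < n → warr s aMark 0 u ≡ 0) →
               Run search s (searchTime n b) (λ s′ → Outer s′ × Components (warr s′ aMark 0) (wvar s′ vC))
  search-run out zeros = thenʷ (thenʷ (thenʷ (thenʷ
    (loop State-of (λ _ _ _ → ≤-refl) step exit (n + n) (out , (z≤n , refl) , start zeros)))))
    where
    step : ∀ d s → State-of d s →
           ⟦ notᵇ (var vN ≤ʷ var vV andᵇ var vT ≤ʷ var vH) ⟧ᵇ s ≡ true →
           ∃[ e ] (d ≡ suc e × Run (ite (var vT ≤ʷ var vH) tryRoot exploreNext) s
                                 (4 + (4 + forTime b 30 + 3 + 30)) (State-of e))
    step d s st@(out , bud , S) g with ∧-false (not-true {(wvar s vN ≤ᵇ wvar s vV) ∧ _} g)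
    ... | c = go d bud c st
      where
      v≢⇒<n : wvar s vV < wvar s vN → wvar s vV < n
      v≢⇒<n = subst (wvar s vV <_) (vN≡ (proj₁ out))
      h≤n : wvar s vH ≤ n
      h≤n = ≤-trans (h≤t S) (t≤n S)
      body : ∀ {e} → State-of (suc e) s →
             (wvar s vT ≤ wvar s vH → wvar s vV < n) → Run (ite (var vT ≤ʷ var vH) tryRoot exploreNext) s
                                 (4 + (4 + forTime b 30 + 3 + 30)) (State-of e)
      body st v<n = branch ≤-refl
        (λ t≤h → slower (m≤n+m 30 (4 + forTime b 30 + 3)) (tryRoot-run (≤ᵇ-true t≤h) (v<n (≤ᵇ-true t≤h)) st))
        (λ h<t → slower (m≤m+n _ 30) (exploreNext-run (≤ᵇ-false h<t) st))
      v<n : (wvar s vN ≤ᵇ wvar s vV) ≡ false ⊎ (wvar s vT ≤ᵇ wvar s vH) ≡ false →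
            wvar s vT ≤ wvar s vH → wvar s vV < n
      v<n (inj₁ v<) _   = v≢⇒<n (≤ᵇ-false v<)
      v<n (inj₂ h<) t≤h = contradiction t≤h (<⇒≱ (≤ᵇ-false h<))
      go : ∀ d → Budget d s → (wvar s vN ≤ᵇ wvar s vV) ≡ false ⊎ (wvar s vT ≤ᵇ wvar s vH) ≡ false →
           State-of d s → ∃[ e ] (d ≡ suc e × Run _ s _ (State-of e))
      go (suc e) _ c st = e , refl , body st (v<n c)
      -- With no budget left both pointers stand at `n`, but a true guard puts one of them below
      -- `n`.
      go zero (v≤n , eq) c st = contradiction (trans (sym (+-identityʳ _)) eq) (<⇒≢ (small c))
        where
        small : (wvar s vN ≤ᵇ wvar s vV) ≡ false ⊎ (wvar s vT ≤ᵇ wvar s vH) ≡ false →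
                wvar s vV + wvar s vH < n + n
        small (inj₁ v<) = +-mono-<-≤ (v≢⇒<n (≤ᵇ-false v<)) h≤n
        small (inj₂ h<) = +-mono-≤-< v≤n (≤-trans (≤ᵇ-false h<) (t≤n S))

    exit : ∀ d s → State-of d s →
           ⟦ notᵇ (var vN ≤ʷ var vV andᵇ var vT ≤ʷ var vH) ⟧ᵇ s ≡ false →
           Outer s × Components (warr s aMark 0) (wvar s vC)
    exit d s (out , bud , S) g with ∧-true (not-false {(wvar s vN ≤ᵇ wvar s vV) ∧ _} g)
    ... | n≤v , t≤h = out , finished S (≤ᵇ-true t≤h)
                       (subst (_≤ wvar s vV) (vN≡ (proj₁ out)) (≤ᵇ-true n≤v))

-- Subsets as binary counters, least significant digit first

bit : Bool → ℕ
bit false = 0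
bit true  = 1

bit-zero : ∀ {m x} → m ≡ bit x → (m ≤ᵇ 0) ≡ true → x ≡ false
bit-zero {x = false} refl _ = refl

bit-nonzero : ∀ {m x} → m ≡ bit x → (m ≤ᵇ 0) ≡ false → x ≡ true
bit-nonzero {x = true} refl _ = refl

odd : ∀ {m} → Vec Bool m → Bool
odd []       = false
odd (x ∷ xs) = x xor odd xs

increment : ∀ {m} → Vec Bool m → Vec Bool m
increment []           = []
increment (false ∷ xs) = true ∷ xs
increment (true ∷ xs)  = false ∷ increment xs

full : ∀ {m} → Vec Bool m → Bool
full []       = true
full (x ∷ xs) = x ∧ full xs

-- The value of the complemented digits, 2^m - 1 minus the counter: the number of increments still
-- to come before all digits are ones.
left : ∀ {m} → Vec Bool m → ℕ
left []           = 0
left (false ∷ xs) = suc (2 * left xs)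
left (true ∷ xs)  = 2 * left xs

left-full : ∀ {m} (xs : Vec Bool m) → full xs ≡ true → left xs ≡ 0
left-full []          _ = refl
left-full (true ∷ xs) f = cong (2 *_) (left-full xs f)

left-increment : ∀ {m} (xs : Vec Bool m) → full xs ≡ false → left xs ≡ suc (left (increment xs))
left-increment (false ∷ xs) _ = refl
left-increment (true ∷ xs)  f = trans (cong (2 *_) (left-increment xs f)) (*-suc 2 _)

left-zeros : ∀ m → suc (left (replicate m false)) ≡ 2 ^ m
left-zeros zero    = refl
left-zeros (suc m) = trans (sym (*-suc 2 _)) (cong (2 *_) (left-zeros m))

-- Sums out the least significant digit. Recursion through it follows the counter: a carry past the
-- first digit is a step of the counter on the remaining digits with the pair sums as terms.
pairSum : ∀ {m} → (Vec Bool (suc m) → ℤ) → Vec Bool m → ℤ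
pairSum f xs = f (false ∷ xs) ℤ.+ f (true ∷ xs)

total : ∀ m → (Vec Bool m → ℤ) → ℤ
total zero    f = f []
total (suc m) f = total m (pairSum f)

-- The part of the total that the counter has still to go through after xs.
sumAfter : ∀ {m} → Vec Bool m → (Vec Bool m → ℤ) → ℤ
sumAfter []           f = + 0
sumAfter (false ∷ xs) f = f (true ∷ xs) ℤ.+ sumAfter xs (pairSum f)
sumAfter (true ∷ xs)  f = sumAfter xs (pairSum f)

sumAfter-full : ∀ {m} (xs : Vec Bool m) f → full xs ≡ true → sumAfter xs f ≡ + 0
sumAfter-full []          f _ = refl
sumAfter-full (true ∷ xs) f e = sumAfter-full xs (pairSum f) e

sumAfter-increment : ∀ {m} (xs : Vec Bool m) f → full xs ≡ false →
                     sumAfter xs f ≡ f (increment xs) ℤ.+ sumAfter (increment xs) f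
sumAfter-increment (false ∷ xs) f _ = refl
sumAfter-increment (true ∷ xs)  f e =
  trans (sumAfter-increment xs (pairSum f) e) (ℤ.+-assoc (f (false ∷ increment xs)) _ _)

total-zeros : ∀ m f → total m f ≡ f (replicate m false) ℤ.+ sumAfter (replicate m false) f
total-zeros zero    f = sym (ℤ.+-identityʳ (f []))
total-zeros (suc m) f =
  trans (total-zeros m (pairSum f)) (ℤ.+-assoc (f (false ∷ replicate m false)) _ _)

Digits : ∀ {m} → (ℕ → ℕ) → ℕ → Vec Bool m → Set
Digits f o []       = ⊤
Digits f o (x ∷ xs) = f o ≡ bit x × Digits f (suc o) xs

Digits-cong : ∀ {m f g} o (xs : Vec Bool m) → (∀ {i} → o ≤ i → f i ≡ g i) → Digits f o xs → Digits g o xs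
Digits-cong o []       _  _        = tt
Digits-cong o (x ∷ xs) eq (d , ds) =
  trans (sym (eq ≤-refl)) d , Digits-cong (suc o) xs (λ o<i → eq (<⇒≤ o<i)) ds

Digits-zeros : ∀ m f o → (∀ i → f i ≡ 0) → Digits f o (replicate m false)
Digits-zeros zero    f o z = tt
Digits-zeros (suc m) f o z = z o , Digits-zeros m f (suc o) z

-- The alternating sum over all subsets.

clear parityOf addTerm next round mainLoop : Program
clear = for vU vN (aMark [ lit 0 , var vU ]≔ʷ lit 0)
parityOf =
  vS ≔ʷ lit 0 ⨾
  for vI vB (vS ≔ʷ cell aXor (cell aSel (lit 0) (var vI)) (var vS))
addTerm =
  ite (var vS ≤ʷ lit 0)
    (zAcc ≔ᶻ var zAcc ⊕ cell aPow (var vC))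
    (zAcc ≔ᶻ var zAcc ⊖ cell aPow (var vC))
next =
  vI ≔ʷ lit 0 ⨾
  while (notᵇ (var vB ≤ʷ var vI) andᵇ lit 1 ≤ʷ cell aSel (lit 0) (var vI))
    (aSel [ lit 0 , var vI ]≔ʷ lit 0 ⨾ vI ≔ʷ succ (var vI)) ⨾
  ite (var vB ≤ʷ var vI) (vD ≔ʷ lit 1) (aSel [ lit 0 , var vI ]≔ʷ lit 1)
round = clear ⨾ parityOf ⨾ search ⨾ addTerm ⨾ next
mainLoop = while (var vD ≤ʷ lit 0) round

module _ {n b tab sel pow acc N B D Tab Sel Xor Pow Acc}
         (ctx : Context′ n b tab sel pow acc N B D Tab Sel Xor Pow Acc) where

  with-acc : ∀ {acc′ Acc′} → Acc′ ≡ acc′ → Context′ n b tab sel pow acc′ N B D Tab Sel Xor Pow Acc′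
  with-acc eq = context (vN≡ ctx) (vB≡ ctx) (vD≡ ctx) (aTab≡ ctx) (aSel≡ ctx) (aXor≡ ctx) (aPow≡ ctx) eq

  with-sel : ∀ {sel′} → Context′ n b tab sel′ pow acc N B D Tab sel′ Xor Pow Acc
  with-sel = context (vN≡ ctx) (vB≡ ctx) (vD≡ ctx) (aTab≡ ctx) refl (aXor≡ ctx) (aPow≡ ctx) (zAcc≡ ctx)

  with-D : Context′ n b tab sel pow acc N B 0 Tab Sel Xor Pow Acc
  with-D = context (vN≡ ctx) (vB≡ ctx) refl (aTab≡ ctx) (aSel≡ ctx) (aXor≡ ctx) (aPow≡ ctx) (zAcc≡ ctx)

xor-table : ∀ x y → xorTable (bit x) (bit y) ≡ bit (x xor y)
xor-table false false = refl
xor-table false true  = refl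
xor-table true  false = refl
xor-table true  true  = refl

signed : Bool → ℕ → ℤ
signed false m = + m
signed true  m = ℤ.- (+ m)

∣signed∣ : ∀ x m → ∣ signed x m ∣ ≡ m
∣signed∣ false m = refl
∣signed∣ true  m = ℤ.∣-i∣≡∣i∣ (+ m)

roundTime mainTime : ℕ → ℕ → ℕ → ℕ
roundTime n b W = forTime n 4 + ((2 + forTime b 6) + (searchTime n b +
                  ((4 + (1 + (W + (1 + W) + W))) + (2 + ((b * (11 + 7) + 11) + 9)))))
mainTime n b W = 2 ^ b * (4 + roundTime n b W) + 4

-- The loop is verified for an abstract size `fixed` of the terms. That these numbers count
-- labelings is supplied where the module is applied. `W` bounds the bits of everything that enters
-- the sum.
module MainRun (n b : ℕ) (tab : ℕ → ℕ → ℕ)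
  (tab< : ∀ {i u} → i < b → u < n → tab i u < n)
  (back : ∀ {i} → i < b → (A : ℕ → Set) → (∀ {u} → u < n → A u → A (tab i u)) →
          ∀ {u} → u < n → A (tab i u) → A u)
  (pow : ℕ → ℤ) (k : ℕ) (1≤k : 1 ≤ k) (pow≡ : ∀ {c} → c ≤ n → pow c ≡ + (k ^ c))
  (fixed : Vec Bool b → ℕ) (fixed≤ : ∀ xs → fixed xs ≤ k ^ n)
  (fixed≡ : ∀ {xs sel M c} → Digits sel 0 xs →
            GraphSearch.Components n b tab sel tab< back M c → fixed xs ≡ k ^ c)
  (W : ℕ) (bits≤W : ∀ z → ∣ z ∣ ≤ 2 ^ b * k ^ n → bits z ≤ W)
  where

  term : Vec Bool b → ℤ
  term xs = signed (odd xs) (fixed xs)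

  module Round (sel : ℕ → ℕ) (acc : ℤ) where

    Ctx : State → Set
    Ctx = Context n b tab sel pow acc

    clear-run : ∀ {s} → Ctx s →
                Run clear s (forTime n 4) (λ s′ → Ctx s′ × (∀ {u} → u < n → warr s′ aMark 0 u ≡ 0))
    clear-run {s} ctx = weaken proj₂
      (for-run (λ i s → Ctx s × (∀ {u} → u < i → warr s aMark 0 u ≡ 0)) refl refl
        (λ i s _ U≡ N≡ (ctx , zeros) →
          setʷ[] (U≡ , N≡ , ctx , λ {u} u<1+i → zero-at i s U≡ zeros u (u ≟ i) u<1+i))
        (vN≡ ctx) (ctx , λ ()))
      where
      zero-at : ∀ i s → wvar s vU ≡ i → (∀ {u} → u < i → warr s aMark 0 u ≡ 0) →
                ∀ u → Dec (u ≡ i) → u < suc i → (warr s aMark 0 [ wvar s vU ↦ 0 ]) u ≡ 0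
      zero-at i s U≡ zeros u (yes refl) _ rewrite U≡ = update-same (warr s aMark 0) i
      zero-at i s U≡ zeros u (no u≢i) u<1+i rewrite U≡ =
        trans (update-other (warr s aMark 0) (≢-sym u≢i)) (zeros (≤∧≢⇒< (≤-pred u<1+i) u≢i))

    Cleared : State → Set
    Cleared s = Ctx s × (∀ {u} → u < n → warr s aMark 0 u ≡ 0)

    parity-run : ∀ {s} {xs : Vec Bool b} → Digits sel 0 xs → Cleared s →
                 Run parityOf s (2 + forTime b 6) (λ s′ → Cleared s′ × wvar s′ vS ≡ bit (odd xs))
    parity-run {s} {xs} digits clr = thenʷ (weaken (λ {s′} (_ , I) → exit s′ I)
      (for-run I refl refl step (vB≡ (proj₁ clr)) (clr , b , xs , false , refl , digits , refl , refl)))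
      where
      I : ℕ → State → Set
      I i s = Cleared s × ∃[ m ] ∃[ ys ] ∃[ q ] (i + m ≡ b × Digits {m} sel i ys ×
                wvar s vS ≡ bit q × q xor odd ys ≡ odd xs)

      step : ∀ i s → i < b → wvar s vI ≡ i → wvar s vB ≡ b → I i s → Run _ s _
               (λ s′ → wvar s′ vI ≡ i × wvar s′ vB ≡ b × I (suc i) (setWVar vI (suc i) s′))
      step i s i<b I≡ B≡ (clr , zero , ys , q , eq , _) =
        contradiction (trans (sym (+-identityʳ i)) eq) (<⇒≢ i<b)
      step i s i<b I≡ B≡ (clr@(ctx , _) , suc m , y ∷ ys , q , eq , (d , ds) , S≡ , par) =
        setʷ (I≡ , B≡ , clr , m , ys , y xor q , trans (sym (+-suc i m)) eq , ds , S′≡ , par′)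
        where
        S′≡ : warr s aXor (warr s aSel 0 (wvar s vI)) (wvar s vS) ≡ bit (y xor q)
        S′≡ rewrite I≡ | S≡ | cong (λ f → f i) (aSel≡ ctx) | d = trans (aXor≡ ctx (bit y) (bit q)) (xor-table y q)
        par′ : (y xor q) xor odd ys ≡ odd xs
        par′ = trans (cong (_xor odd ys) (xor-comm y q)) (trans (xor-assoc q y (odd ys)) par)

      exit : ∀ s → I b s → Cleared s × wvar s vS ≡ bit (odd xs)
      exit s (clr , zero , [] , q , _ , _ , S≡ , par) =
        clr , trans S≡ (cong bit (trans (sym (xor-identityʳ q)) par))
      exit s (clr , suc m , _ , _ , eq , _) = contradiction (sym eq) (<⇒≢ (m<m+n b (s≤s z≤n)))

    addTerm-run : ∀ {s xs c} → Ctx s → ∣ acc ∣ ≤ 2 ^ b * k ^ n → wvar s vS ≡ bit (odd {b} xs) →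
                  wvar s vC ≡ c → c ≤ n → fixed xs ≡ k ^ c →
                  Run addTerm s (4 + (1 + (W + (1 + W) + W)))
                    (Context n b tab sel pow (acc ℤ.+ term xs))
    addTerm-run {s} {xs} {c} ctx acc≤ S≡ refl c≤n fixed≡ = branch ≤-refl pos neg
      where
      acc-bits : bits (zvar s zAcc) ≤ W
      acc-bits rewrite zAcc≡ ctx = bits≤W acc acc≤
      powᵢ : zarr s aPow (wvar s vC) ≡ + (k ^ c)
      powᵢ = trans (cong (λ f → f c) (aPow≡ ctx)) (pow≡ c≤n)
      instance
        2^b≢0 : NonZero (2 ^ b)
        2^b≢0 = m^n≢0 2 b
        k≢0 : NonZero k
        k≢0 = >-nonZero 1≤k
      pow-bits : bits (zarr s aPow (wvar s vC)) ≤ W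
      pow-bits rewrite powᵢ = bits≤W (+ (k ^ c)) (≤-trans (^-monoʳ-≤ k c≤n) (m≤n*m (k ^ n) (2 ^ b)))
      cost : bits (zvar s zAcc) + (1 + bits (zarr s aPow (wvar s vC)))
             + maxBits (zvar s zAcc) (zarr s aPow (wvar s vC)) ≤ W + (1 + W) + W
      cost = +-mono-≤ (+-mono-≤ acc-bits (s≤s pow-bits)) (⊔-lub acc-bits pow-bits)
      power : zarr s aPow (wvar s vC) ≡ + fixed xs
      power = trans powᵢ (cong +_ (sym fixed≡))
      pos : (wvar s vS ≤ᵇ 0) ≡ true →
            Run (zAcc ≔ᶻ var zAcc ⊕ cell aPow (var vC)) s _ (Context n b tab sel pow (acc ℤ.+ term xs))
      pos g = setᶻ cost (with-acc ctx (cong₂ ℤ._+_ (zAcc≡ ctx)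
        (trans power (cong (λ x → signed x (fixed xs)) (sym (bit-zero S≡ g))))))
      neg : (wvar s vS ≤ᵇ 0) ≡ false →
            Run (zAcc ≔ᶻ var zAcc ⊖ cell aPow (var vC)) s _ (Context n b tab sel pow (acc ℤ.+ term xs))
      neg g = setᶻ cost (with-acc ctx (cong₂ ℤ._+_ (zAcc≡ ctx)
        (trans (cong ℤ.-_ power) (cong (λ x → signed x (fixed xs)) (sym (bit-nonzero S≡ g))))))

  Outside : ℤ → State → Set
  Outside acc s = Context n b tab (warr s aSel 0) pow acc s

  -- `Context` demands that `vD` be 0, which fails after the last subset. Resetting `vD` in the
  -- state spoken of keeps the other components of the context available in both cases.
  Advanced : ℤ → Vec Bool b → State → Set
  Advanced acc xs s = Context n b tab (warr s aSel 0) pow acc (setWVar vD 0 s) ×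
    ( (full xs ≡ true × wvar s vD ≡ 1)
    ⊎ (full xs ≡ false × wvar s vD ≡ 0 × Digits (warr s aSel 0) 0 (increment xs)))

  -- Every increment is charged for `b` carries. Amortisation would gain nothing, as the search of
  -- the same round already costs on the order of n b.
  next-run : ∀ {s xs acc} → Outside acc s → Digits {b} (warr s aSel 0) 0 xs →
             Run next s (2 + ((b * (11 + 7) + 11) + 9))
               (Advanced acc xs)
  next-run {s} {xs} {acc} ctx digits = thenʷ
    (loop J (λ _ _ _ → ≤-refl) step exit b (ctx , xs , refl , digits , refl , λ f ds _ → ds) >>
     λ {s′} K → at-most 9 (branch ≤-refl
       (λ g → at-most 4 (setʷ (overflow s′ K (≤ᵇ-true g))))
       (λ g → at-most 4 (setʷ[] (carry s′ K (≤ᵇ-false g))))))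
    where
    -- The digits below `vI` were ones and are zeros now. The last component is a continuation: it
    -- turns the increment of the remaining digits `ys` into that of `xs`, so the prefix never has
    -- to be named.
    J : ℕ → State → Set
    J m s = Outside acc s × ∃[ ys ] (wvar s vI + m ≡ b × Digits {m} (warr s aSel 0) (wvar s vI) ys ×
              full ys ≡ full xs ×
              (∀ f → Digits f (wvar s vI) (increment ys) → (∀ {j} → j < wvar s vI → f j ≡ warr s aSel 0 j) →
                 Digits f 0 (increment xs)))

    step : ∀ d s → J d s →
           not (wvar s vB ≤ᵇ wvar s vI) ∧ (1 ≤ᵇ warr s aSel 0 (wvar s vI)) ≡ true →
           ∃[ e ] (d ≡ suc e × Run _ s 7 (J e))
    step zero s (ctx , _ , eq , _) g = contradiction (trans (sym (+-identityʳ _)) (trans eq (sym (vB≡ ctx))))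
      (<⇒≢ (≤ᵇ-false (not-true {wvar s vB ≤ᵇ wvar s vI} (proj₁ (∧-true g)))))
    step (suc e) s (ctx , false ∷ ys , eq , (d , ds) , fl , rest) g =
      contradiction (≤ᵇ-true (proj₂ (∧-true {not (wvar s vB ≤ᵇ wvar s vI)} g))) (<⇒≱ (≤-reflexive (cong suc d)))
    step (suc e) s (ctx , true ∷ ys , eq , (d , ds) , fl , rest) g = e , refl ,
      thenʷ[] (setʷ
        ( with-sel ctx
        , ys , trans (sym (+-suc i e)) eq
        , Digits-cong (suc i) ys (λ i<j → sym (update-other sel (<⇒≢ i<j))) ds
        , fl
        , λ f ds′ agree → rest f
            (trans (agree ≤-refl) (update-same sel i) , ds′)
            (λ j<i → trans (agree (m<n⇒m<1+n j<i)) (update-other sel (≢-sym (<⇒≢ j<i))))))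
      where
      i : ℕ
      i = wvar s vI
      sel : ℕ → ℕ
      sel = warr s aSel 0

    Stopped : State → Set
    Stopped s = ∃[ m ] (J m s × (wvar s vI < b → warr s aSel 0 (wvar s vI) ≡ 0))

    exit : ∀ d s → J d s →
           not (wvar s vB ≤ᵇ wvar s vI) ∧ (1 ≤ᵇ warr s aSel 0 (wvar s vI)) ≡ false → Stopped s
    exit d s j@(ctx , _) g = d , j , zero-digit (∧-false g)
      where
      zero-digit : not (wvar s vB ≤ᵇ wvar s vI) ≡ false ⊎ (1 ≤ᵇ warr s aSel 0 (wvar s vI)) ≡ false →
                   wvar s vI < b → warr s aSel 0 (wvar s vI) ≡ 0
      zero-digit (inj₁ g) i<b = contradiction (subst (wvar s vI <_) (sym (vB≡ ctx)) i<b)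
        (≤⇒≯ (≤ᵇ-true (not-false {wvar s vB ≤ᵇ wvar s vI} g)))
      zero-digit (inj₂ g) _ = n≤0⇒n≡0 (≤-pred (≤ᵇ-false g))

    overflow : ∀ s → Stopped s → wvar s vB ≤ wvar s vI → Advanced acc xs (setWVar vD 1 s)
    overflow s (zero , (ctx , [] , eq , _ , fl , _) , _) b≤i =
      with-D ctx , inj₁ (sym fl , refl)
    overflow s (suc m , (ctx , _ , eq , _) , _) b≤i =
      contradiction (trans (vB≡ ctx) (sym eq)) (<⇒≢ (≤-trans (s≤s b≤i) (m<m+n (wvar s vI) (s≤s z≤n))))

    carry : ∀ s → Stopped s → wvar s vI < wvar s vB → Advanced acc xs (setWArr aSel 0 (wvar s vI) 1 s)
    carry s (zero , (ctx , _ , eq , _) , _) i<b =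
      contradiction (trans (sym (+-identityʳ _)) (trans eq (sym (vB≡ ctx)))) (<⇒≢ i<b)
    carry s (suc m , (ctx , true ∷ ys , eq , (d , _) , _) , z) i<b =
      contradiction (trans (sym d) (z (subst (wvar s vI <_) (vB≡ ctx) i<b))) λ ()
    carry s (suc m , (ctx , false ∷ ys , eq , (d , ds) , fl , rest) , _) i<b =
      with-D (with-sel ctx) , inj₂ (sym fl , vD≡ ctx , rest _
        ( update-same sel i
        , Digits-cong (suc i) ys (λ i<j → sym (update-other sel (<⇒≢ i<j))) ds)
        (λ j<i → update-other sel (≢-sym (<⇒≢ j<i))))
      where
      i : ℕ
      i = wvar s vI
      sel : ℕ → ℕ
      sel = warr s aSel 0

  round-run : ∀ {s xs sel acc} → Context n b tab sel pow acc s → Digits {b} sel 0 xs →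
              ∣ acc ∣ ≤ 2 ^ b * k ^ n → Run round s (roundTime n b W) (Advanced (acc ℤ.+ term xs) xs)
  round-run {s} {xs} {sel} {acc} ctx digits acc≤ =
    clear-run ctx >> λ {s} clr →
    parity-run {s} {xs} digits clr >> λ ((ctx , zeros) , S≡) →
    SearchRun.search-run n b tab sel tab< back pow acc (bit (odd xs)) (ctx , S≡) zeros >>
    λ {s} ((ctx , S≡) , comps) →
    addTerm-run {s} {xs} ctx acc≤ S≡ refl (GraphSearch.Components.cnt≤n comps) (fixed≡ digits comps) >> λ {s} ctx →
    next-run {s} {xs} (with-sel ctx) (subst (λ f → Digits f 0 xs) (sym (aSel≡ ctx)) digits)
    where open Round sel acc

  main-run : ∀ {s} → Outside (+ 0) s → (∀ i → warr s aSel 0 i ≡ 0) →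
             Run mainLoop s (mainTime n b W) (λ s′ → zvar s′ zAcc ≡ total b term)
  main-run ctx zeros = loop I (λ _ _ _ → ≤-refl) step exit (2 ^ b)
    (inj₁ (replicate b false , _ , _ , ctx , Digits-zeros b _ 0 zeros , sym (left-zeros b)
          , trans (ℤ.+-identityˡ _) (sym (total-zeros b term)) , ≤-refl))
    where
    I : ℕ → State → Set
    I d s = (∃[ xs ] ∃[ sel ] ∃[ acc ]
               ( Context n b tab sel pow acc s × Digits {b} sel 0 xs × d ≡ suc (left xs)
               × acc ℤ.+ (term xs ℤ.+ sumAfter xs term) ≡ total b term
               -- Each of the `d` terms to come has absolute value at most `k ^ n`. Reserving room
               -- for them bounds every partial sum, whatever the signs, and thus the cost of each
               -- addition.
               × ∣ acc ∣ + d * k ^ n ≤ 2 ^ b * k ^ n))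
          ⊎ (d ≡ 0 × wvar s vD ≡ 1 × zvar s zAcc ≡ total b term)

    step : ∀ d s → I d s → (wvar s vD ≤ᵇ 0) ≡ true → ∃[ e ] (d ≡ suc e × Run round s (roundTime n b W) (I e))
    step d s (inj₂ (_ , D≡1 , _)) g = contradiction (subst (_≤ 0) D≡1 (≤ᵇ-true g)) λ ()
    step d s (inj₁ (xs , sel , acc , ctx , digits , refl , sum , bound)) g =
      left xs , refl , weaken (λ {s} → after s)
        (round-run {s} ctx digits (≤-trans (m≤m+n ∣ acc ∣ _) bound))
      where
      acc′ : ℤ
      acc′ = acc ℤ.+ term xs
      bound′ : ∣ acc′ ∣ + left xs * k ^ n ≤ 2 ^ b * k ^ n
      bound′ = begin
        ∣ acc′ ∣ + left xs * k ^ n               ≤⟨ +-monoˡ-≤ _ (ℤ.∣i+j∣≤∣i∣+∣j∣ acc (term xs)) ⟩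
        ∣ acc ∣ + ∣ term xs ∣ + left xs * k ^ n  ≡⟨ cong (λ m → ∣ acc ∣ + m + left xs * k ^ n) (∣signed∣ (odd xs) (fixed xs)) ⟩
        ∣ acc ∣ + fixed xs + left xs * k ^ n     ≤⟨ +-monoˡ-≤ _ (+-monoʳ-≤ ∣ acc ∣ (fixed≤ xs)) ⟩
        ∣ acc ∣ + k ^ n + left xs * k ^ n        ≡⟨ +-assoc ∣ acc ∣ _ _ ⟩
        ∣ acc ∣ + suc (left xs) * k ^ n          ≤⟨ bound ⟩
        2 ^ b * k ^ n                            ∎
        where open ≤-Reasoning
      sum′ : acc′ ℤ.+ sumAfter xs term ≡ total b term
      sum′ = trans (ℤ.+-assoc acc (term xs) (sumAfter xs term)) sum
      after : ∀ s → Advanced acc′ xs s → I (left xs) s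
      after s (ctx′ , inj₁ (f , D≡1)) = inj₂ (left-full xs f , D≡1 , trans (zAcc≡ ctx′)
        (trans (sym (ℤ.+-identityʳ acc′)) (trans (cong (λ z → acc′ ℤ.+ z) (sym (sumAfter-full xs term f))) sum′)))
      after s (ctx′ , inj₂ (f , D≡0 , digits′)) = inj₁
        ( increment xs , _ , acc′
        , context (vN≡ ctx′) (vB≡ ctx′) D≡0 (aTab≡ ctx′) refl (aXor≡ ctx′) (aPow≡ ctx′) (zAcc≡ ctx′)
        , digits′ , left-increment xs f
        , trans (cong (λ z → acc′ ℤ.+ z) (sym (sumAfter-increment xs term f))) sum′
        , bound′)

    exit : ∀ d s → I d s → (wvar s vD ≤ᵇ 0) ≡ false → zvar s zAcc ≡ total b term
    exit d s (inj₂ (_ , _ , eq)) _ = eq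
    exit d s (inj₁ (xs , sel , acc , ctx , _)) g = contradiction (≤ᵇ-false g) (<⇒≱ (s≤s (≤-reflexive (vD≡ ctx))))

-- The powers of k, by shift-and-add multiplication

-- The machine has no division, so the binary digits of `k` are found from the top by comparing with
-- tabulated powers of two and subtracting them. The product follows Horner's scheme: double, then
-- add `k ^ j` if the digit is one.
powersOfTwo mulStep powersOfK : Program
powersOfTwo =
  aTwo [ lit 0 ]≔ᶻ lit (+ 1) ⨾
  vM ≔ʷ lit 0 ⨾
  while (cell aTwo (var vM) ≤ᶻ var zK)
    (aTwo [ succ (var vM) ]≔ᶻ cell aTwo (var vM) ⊕ cell aTwo (var vM) ⨾
     vM ≔ʷ succ (var vM))
mulStep =
  vI ≔ʷ pre (var vI) ⨾
  zProd ≔ᶻ var zProd ⊕ var zProd ⨾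
  ite (cell aTwo (var vI) ≤ᶻ var zRest)
    (zRest ≔ᶻ var zRest ⊖ cell aTwo (var vI) ⨾
     zProd ≔ᶻ var zProd ⊕ cell aPow (var vJ))
    skip
powersOfK =
  aPow [ lit 0 ]≔ᶻ lit (+ 1) ⨾
  for vJ vN
    (zProd ≔ᶻ lit (+ 0) ⨾
     zRest ≔ᶻ var zK ⨾
     vI ≔ʷ var vM ⨾
     while (lit 1 ≤ʷ var vI) mulStep ⨾
     aPow [ succ (var vJ) ]≔ᶻ var zProd)

-- The common shape of the costs of integer addition, subtraction and comparison; `c` and `d` are
-- the costs of an array index, 0 for a plain variable.
sum-bits : ∀ {Z} c x d y → bits x ≤ Z → bits y ≤ Z → (c + bits x) + (d + bits y) + maxBits x y ≤ (c + Z) + (d + Z) + Z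
sum-bits c x d y p q = +-mono-≤ (+-mono-≤ (+-monoʳ-≤ c p) (+-monoʳ-≤ d q)) (⊔-lub p q)

power≤⇒≤log : ∀ {m k} → 2 ^ m ≤ k → m ≤ ⌊log₂ k ⌋
power≤⇒≤log {m} p = subst (_≤ _) (⌊log₂[2^n]⌋≡n m) (⌊log₂⌋-mono-≤ p)

twoTime : ℕ → ℕ → ℕ
twoTime l Z = 3 + (2 + (suc l * (1 + (1 + Z + Z + Z) + (3 + ((1 + Z) + (1 + Z) + Z) + 3))
                        + (1 + (1 + Z + Z + Z))))

mulTime : ℕ → ℕ
mulTime Z = 3 + (1 + (Z + Z + Z) + (1 + (1 + Z + Z + Z) +
            (1 + (Z + (1 + Z) + Z) + (1 + (Z + (1 + Z) + Z)))))

powerTime : ℕ → ℕ → ℕ → ℕ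
powerTime n l Z = 3 + forTime n (2 + (1 + Z + (2 + (suc l * (1 + 3 + mulTime Z) + (1 + 3) + (3 + Z)))))

-- The tabulated powers of two stay within `2 * k`, as the first one beyond `k` is kept too, and
-- partial products stay within `k ^ n`. For n at least 1 both are covered by `2 * k ^ n`.
module PowerRun (n k : ℕ) (1≤n : 1 ≤ n) (1≤k : 1 ≤ k)
  (Z : ℕ) (bits≤Z : ∀ m → m ≤ 2 * k ^ n → bits (+ m) ≤ Z)
  (a : ℕ) (words : ℕ → ℕ → ℕ → ℕ)
  where

  Keep : State → Set
  Keep s = wvar s vN ≡ n × wvar s vA ≡ a × wvar s vD ≡ 0 × warr s ≡ words
         × zvar s zK ≡ + k × zvar s zAcc ≡ + 0

  zK-is : ∀ {s} → Keep s → zvar s zK ≡ + k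
  zK-is (_ , _ , _ , _ , K≡ , _) = K≡

  k≤kⁿ : ∀ {j} → j < n → k * k ^ j ≤ k ^ n
  k≤kⁿ j<n = ^-monoʳ-≤ k {{>-nonZero 1≤k}} j<n

  k≤ : k ≤ k ^ n
  k≤ = ≤-trans (≤-reflexive (sym (*-identityʳ k))) (k≤kⁿ 1≤n)

  double : ∀ {m} → m ≤ k ^ n → m ≤ 2 * k ^ n
  double m≤ = ≤-trans m≤ (m≤m+n (k ^ n) _)

  bits≡ : ∀ {z m} → z ≡ + m → m ≤ 2 * k ^ n → bits z ≤ Z
  bits≡ {m = m} refl m≤ = bits≤Z m m≤

  Twos : ℕ → State → Set
  Twos m s = wvar s vM ≡ m × 2 ^ m ≤ 2 * k × (∀ {i} → i ≤ m → zarr s aTwo i ≡ + (2 ^ i))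

  TwosDone : State → Set
  TwosDone s = Keep s × ∃[ m ] (m ≤ suc ⌊log₂ k ⌋ × k < 2 ^ m × Twos m s)

  twos-run : ∀ {s} → Keep s → Run powersOfTwo s (twoTime ⌊log₂ k ⌋ Z) TwosDone
  twos-run keep = thenᶻ[] ≤-refl (thenʷ
    (loop I cost step exit (suc ⌊log₂ k ⌋)
      (keep , 0 , refl , refl , ≤-trans 1≤k (m≤m+n k _) , λ { z≤n → refl })))
    where
    I : ℕ → State → Set
    I d s = Keep s × ∃[ m ] (m + d ≡ suc ⌊log₂ k ⌋ × Twos m s)

    two-bits : ∀ {m s} → Twos m s → bits (zarr s aTwo (wvar s vM)) ≤ Z
    two-bits (refl , m≤ , twos) = bits≡ (twos ≤-refl) (≤-trans m≤ (*-monoʳ-≤ 2 k≤))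

    cost : ∀ d s → I d s → costᵇ (cell aTwo (var vM) ≤ᶻ var zK) s ≤ 1 + Z + Z + Z
    cost d s (keep , m , _ , twos) =
      sum-bits 1 (zarr s aTwo (wvar s vM)) 0 (zvar s zK) (two-bits {s = s} twos) (bits≡ (zK-is {s} keep) (double k≤))

    step : ∀ d s → I d s → (zarr s aTwo (wvar s vM) ℤ.≤ᵇ zvar s zK) ≡ true →
           ∃[ e ] (d ≡ suc e × Run _ s (3 + ((1 + Z) + (1 + Z) + Z) + 3) (I e))
    step d s (keep , m , eq , tw@(refl , m≤ , twos)) g = go d eq
      where
      2^m≤k : 2 ^ m ≤ k
      2^m≤k = ≤ᵇ-true (trans (cong₂ ℤ._≤ᵇ_ (sym (twos ≤-refl)) (sym (zK-is {s} keep))) g)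
      value : zarr s aTwo m ℤ.+ zarr s aTwo m ≡ + (2 ^ suc m)
      value = trans (cong₂ ℤ._+_ (twos ≤-refl) (twos ≤-refl)) (cong (λ z → + (2 ^ m + z)) (sym (+-identityʳ (2 ^ m))))
      extended : ∀ {i} → Dec (i ≡ suc m) → i ≤ suc m →
                 (zarr s aTwo [ suc m ↦ zarr s aTwo m ℤ.+ zarr s aTwo m ]) i ≡ + (2 ^ i)
      extended (yes refl) _ = trans (update-same (zarr s aTwo) (suc m)) value
      extended (no i≢) i≤ = trans (update-other (zarr s aTwo) (≢-sym i≢)) (twos (≤-pred (≤∧≢⇒< i≤ i≢)))
      go : ∀ d → m + d ≡ suc ⌊log₂ k ⌋ → ∃[ e ] (d ≡ suc e × Run _ s _ (I e))
      go zero eq = contradiction (trans (sym (+-identityʳ m)) eq) (<⇒≢ (s≤s (power≤⇒≤log 2^m≤k)))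
      go (suc e) eq = e , refl , thenᶻ[]
        (sum-bits 1 (zarr s aTwo m) 1 (zarr s aTwo m) (two-bits {s = s} tw) (two-bits {s = s} tw)) (setʷ
        (keep , suc m , trans (sym (+-suc m e)) eq , refl , *-monoʳ-≤ 2 2^m≤k ,
         λ {i} → extended (i ≟ suc m)))

    exit : ∀ d s → I d s → (zarr s aTwo (wvar s vM) ℤ.≤ᵇ zvar s zK) ≡ false → TwosDone s
    exit d s (keep , m , eq , tw@(refl , m≤ , twos)) g =
      keep , m , ≤-trans (m≤m+n m d) (≤-reflexive eq) ,
      ≤ᵇ-false (trans (cong₂ ℤ._≤ᵇ_ (sym (twos ≤-refl)) (sym (zK-is {s} keep))) g) , tw

  module _ (m : ℕ) (m≤ : m ≤ suc ⌊log₂ k ⌋) (k<2^m : k < 2 ^ m) where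

    Powers : ℕ → State → Set
    Powers j s = Keep s × Twos m s × (∀ {c} → c ≤ j → zarr s aPow c ≡ + (k ^ c))

    -- The first digits of k, down to the i-th, form q and the remaining ones r.
    Multiplying : ℕ → ℕ → State → Set
    Multiplying j i s = Powers j s × wvar s vN ≡ n × wvar s vJ ≡ j × wvar s vI ≡ i × i ≤ m ×
      ∃[ q ] ∃[ r ] (k ≡ q * 2 ^ i + r × r < 2 ^ i × zvar s zProd ≡ + (q * k ^ j) × zvar s zRest ≡ + r)

    mulStep-run : ∀ j e s → j < n → Multiplying j (suc e) s → Run mulStep s (mulTime Z) (Multiplying j e)
    mulStep-run j e s j<n (P@(keep , (M≡ , 2^m≤ , twos) , pows) , N≡ , J≡ , I≡ , e<m , q , r , k≡ , r< , P≡ , R≡) =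
      thenʷ (thenᶻ (sum-bits 0 (zvar s zProd) 0 (zvar s zProd) prod-bits prod-bits)
        (branch (sum-bits 1 (zarr s aTwo i) 0 (zvar s zRest) two-bits rest-bits)
          (λ g → thenᶻ (sum-bits 0 (zvar s zRest) 1 (zarr s aTwo i) rest-bits two-bits)
            (setᶻ (sum-bits 0 (zvar s zProd ℤ.+ zvar s zProd) 1 (zarr s aPow (wvar s vJ)) prod-bits′ pow-bits)
              (taken g)))
          (λ g → slower (s≤s z≤n) (done (left-out g)))))
      where
      i : ℕ
      i = pred (wvar s vI)
      A x : ℕ
      A = k ^ j
      x = 2 ^ e
      i≡ : i ≡ e
      i≡ = cong pred I≡
      two≡ : zarr s aTwo i ≡ + x
      two≡ = trans (cong (zarr s aTwo) i≡) (twos (<⇒≤ e<m))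
      pow≡ : zarr s aPow (wvar s vJ) ≡ + A
      pow≡ = trans (cong (zarr s aPow) J≡) (pows ≤-refl)
      k≡2q : k ≡ (q + q) * x + r
      k≡2q = trans k≡ (lemma q x r)
        where
        lemma : ∀ q x r → q * (2 * x) + r ≡ (q + q) * x + r
        lemma = solve-∀
      prod≡ : zvar s zProd ℤ.+ zvar s zProd ≡ + ((q + q) * A)
      prod≡ = trans (cong₂ ℤ._+_ P≡ P≡) (cong +_ (sym (*-distribʳ-+ A q q)))
      x>0 : NonZero x
      x>0 = m^n≢0 2 e
      -- The doubled prefix of digits is multiplied by `x`, which is at least 1, to give at most
      -- `k`. So no intermediate product exceeds `k * k ^ j`.
      2q≤k : q + q ≤ k
      2q≤k = ≤-trans (m≤m*n (q + q) x {{x>0}}) (≤-trans (m≤m+n _ r) (≤-reflexive (sym k≡2q)))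
      A≤ : k * A ≤ 2 * k ^ n
      A≤ = double (k≤kⁿ j<n)
      two-bits : bits (zarr s aTwo i) ≤ Z
      two-bits = bits≡ two≡ (≤-trans (^-monoʳ-≤ 2 (<⇒≤ e<m)) (≤-trans 2^m≤ (*-monoʳ-≤ 2 k≤)))
      pow-bits : bits (zarr s aPow (wvar s vJ)) ≤ Z
      pow-bits = bits≡ pow≡ (≤-trans (m≤n*m A k {{>-nonZero 1≤k}}) A≤)
      rest-bits : bits (zvar s zRest) ≤ Z
      rest-bits = bits≡ R≡ (≤-trans (m≤n+m r ((q + q) * x)) (≤-trans (≤-reflexive (sym k≡2q)) (double k≤)))
      prod-bits′ : bits (zvar s zProd ℤ.+ zvar s zProd) ≤ Z
      prod-bits′ = bits≡ prod≡ (≤-trans (*-monoˡ-≤ A 2q≤k) A≤)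
      prod-bits : bits (zvar s zProd) ≤ Z
      prod-bits = bits≡ P≡ (≤-trans (*-monoˡ-≤ A (≤-trans (m≤m+n q q) 2q≤k)) A≤)

      s₁ : State
      s₁ = setZVar zProd (zvar s zProd ℤ.+ zvar s zProd) (setWVar vI i s)

      left-out : (zarr s aTwo i ℤ.≤ᵇ zvar s zRest) ≡ false → Multiplying j e s₁
      left-out g = P , N≡ , J≡ , i≡ , <⇒≤ e<m , q + q , r , k≡2q ,
        ≤ᵇ-false (trans (sym (cong₂ ℤ._≤ᵇ_ two≡ R≡)) g) , prod≡ , R≡

      taken : (zarr s aTwo i ℤ.≤ᵇ zvar s zRest) ≡ true →
              Multiplying j e (setZVar zProd (zvar s zProd ℤ.+ zvar s zProd ℤ.+ zarr s aPow (wvar s vJ))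
                                (setZVar zRest (zvar s zRest ℤ.- zarr s aTwo i) s₁))
      taken g = P , N≡ , J≡ , i≡ , <⇒≤ e<m , suc (q + q) , r ∸ x , k≡′ , r<′ ,
        trans (cong₂ ℤ._+_ prod≡ pow≡) (cong +_ (+-comm ((q + q) * A) A)) ,
        trans (cong₂ ℤ._-_ R≡ two≡) (trans (ℤ.m-n≡m⊖n r x) (ℤ.⊖-≥ x≤r))
        where
        x≤r : x ≤ r
        x≤r = ≤ᵇ-true (trans (sym (cong₂ ℤ._≤ᵇ_ two≡ R≡)) g)
        k≡′ : k ≡ suc (q + q) * x + (r ∸ x)
        k≡′ = trans k≡2q (trans (cong (λ z → (q + q) * x + z) (sym (m+[n∸m]≡n x≤r))) (lemma ((q + q) * x) x (r ∸ x)))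
          where
          lemma : ∀ y x z → y + (x + z) ≡ (x + y) + z
          lemma = solve-∀
        r<′ : r ∸ x < x
        r<′ = +-cancelˡ-< x (r ∸ x) x
          (subst₂ _<_ (sym (m+[n∸m]≡n x≤r)) (cong (λ y → x + y) (+-identityʳ x)) r<)

    powers-run : ∀ {s} → Keep s → Twos m s → Run powersOfK s (powerTime n ⌊log₂ k ⌋ Z) (Powers n)
    powers-run keep twos = thenᶻ[] ≤-refl
      (weaken proj₂ (for-run Powers refl refl body (proj₁ keep) (keep , twos , λ { z≤n → refl })))
      where
      body : ∀ j s → j < n → wvar s vJ ≡ j → wvar s vN ≡ n → Powers j s → Run _ s _
               (λ s′ → wvar s′ vJ ≡ j × wvar s′ vN ≡ n × Powers (suc j) (setWVar vJ (suc j) s′))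
      body j s j<n J≡ N≡ P@(keep , (M≡ , _) , _) =
        thenᶻ ≤-refl (thenᶻ (bits≡ (zK-is {s} keep) (double k≤)) (thenʷ
          (slower (+-monoˡ-≤ 4 (*-monoˡ-≤ (1 + 3 + mulTime Z) m≤))
            (loop (Multiplying j) (λ _ _ _ → ≤-refl) step (λ d s → exit d s) m
              (P , N≡ , J≡ , M≡ , ≤-refl , 0 , k , refl , k<2^m , refl , zK-is {s} keep))
           >> λ {s′} ((keep′ , twos′ , pows) , J≡ , P≡) →
              setᶻ[] (bits≡ P≡ (double (k≤kⁿ j<n)))
                (J≡ , proj₁ keep′ , keep′ , twos′ , λ {c} → extended s′ J≡ P≡ pows c (c ≟ suc j)))))
        where
        Product : State → Set
        Product s = Powers j s × wvar s vJ ≡ j × zvar s zProd ≡ + (k * k ^ j)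

        step : ∀ d s → Multiplying j d s → (1 ≤ᵇ wvar s vI) ≡ true →
               ∃[ e ] (d ≡ suc e × Run mulStep s (mulTime Z) (Multiplying j e))
        step zero s (_ , _ , _ , I≡ , _) g = contradiction (subst (1 ≤_) I≡ (≤ᵇ-true g)) λ ()
        step (suc e) s mul g = e , refl , mulStep-run j e s j<n mul

        exit : ∀ d s → Multiplying j d s → (1 ≤ᵇ wvar s vI) ≡ false → Product s
        exit (suc d) s (_ , _ , _ , I≡ , _) g = contradiction (subst (_< 1) I≡ (≤ᵇ-false g)) λ { (s≤s ()) }
        exit zero s (P , _ , J≡ , _ , _ , q , zero , k≡ , _ , P≡ , _) g =
          P , J≡ , trans P≡ (cong (λ m → + (m * k ^ j))
                     (trans (sym (*-identityʳ q)) (trans (sym (+-identityʳ (q * 1))) (sym k≡))))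
        exit zero s (_ , _ , _ , _ , _ , q , suc r , _ , s≤s () , _) g

        extended : ∀ s → wvar s vJ ≡ j → zvar s zProd ≡ + (k * k ^ j) →
                   (∀ {c} → c ≤ j → zarr s aPow c ≡ + (k ^ c)) →
                   ∀ c → Dec (c ≡ suc j) → c ≤ suc j →
                   (zarr s aPow [ suc (wvar s vJ) ↦ zvar s zProd ]) c ≡ + (k ^ c)
        extended s refl P≡ pows c (yes refl) _ = trans (update-same (zarr s aPow) c) P≡
        extended s refl P≡ pows c (no c≢) c≤ =
          trans (update-other (zarr s aPow) (≢-sym c≢)) (pows (≤-pred (≤∧≢⇒< c≤ c≢)))

-- Removing the identity from the list of automorphisms

IsId : ∀ {n} → Permutation′ n → Set
IsId π = ∀ v → π ⟨$⟩ʳ v ≡ v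

moves? : ∀ {n} (π : Permutation′ n) → Dec (¬ IsId π)
moves? π = ¬? (all? λ v → π ⟨$⟩ʳ v Finₚ.≟ v)

Row : ∀ {n} → (ℕ → ℕ → ℕ) → ℕ → Permutation′ n → Set
Row f i π = ∀ v → f i (toℕ v) ≡ toℕ (π ⟨$⟩ʳ v)

Table : ∀ {n} → (ℕ → ℕ → ℕ) → ℕ → List (Permutation′ n) → Set
Table f o []       = ⊤
Table f o (π ∷ πs) = Row f o π × Table f (suc o) πs

Table-cong : ∀ {n f g} o (πs : List (Permutation′ n)) → (∀ {i} → i < o + length πs → f i ≡ g i) →
             Table f o πs → Table g o πs
Table-cong o []       eq t       = tt
Table-cong o (ρ ∷ πs) eq (x , t) =
  (λ v → trans (cong (λ f → f (toℕ v)) (sym (eq (m<m+n o (s≤s z≤n))))) (x v)) ,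
  Table-cong (suc o) πs (λ p → eq (≤-trans p (≤-reflexive (sym (+-suc o _))))) t

Table-snoc : ∀ {n f} o (πs : List (Permutation′ n)) {π} →
             Table f o πs → Row f (o + length πs) π → Table f o (πs ++ π ∷ [])
Table-snoc {f = f} o []       {π} t       r = subst (λ i → Row f i π) (+-identityʳ o) r , tt
Table-snoc {f = f} o (ρ ∷ πs) {π} (x , t) r = x , Table-snoc (suc o) πs t (subst (λ i → Row f i π) (+-suc o _) r)

Table-++ : ∀ {n f} o (ρs : List (Permutation′ n)) {π πs} → Table f o (ρs ++ π ∷ πs) → Row f (o + length ρs) π
Table-++ {f = f} o []       {π} (r , _) = subst (λ i → Row f i π) (sym (+-identityʳ o)) r
Table-++ {f = f} o (_ ∷ ρs) {π} (_ , t) = subst (λ i → Row f i π) (sym (+-suc o _)) (Table-++ (suc o) ρs t)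

entry-tabulate : ∀ {n} (f : Fin n → ℕ) v → entry 0 (tabulate f) (toℕ v) ≡ f v
entry-tabulate f Fin.zero    = refl
entry-tabulate f (Fin.suc v) = entry-tabulate (f ∘ Fin.suc) v

input-table : ∀ {n} (πs ρs : List (Permutation′ n)) →
              Table (matrix (map oneLine (ρs ++ πs))) (length ρs) πs
input-table []       ρs = tt
input-table (π ∷ πs) ρs = row ρs , subst₂ (λ σs m → Table (matrix (map oneLine σs)) m πs)
  (++-assoc ρs (π ∷ []) πs) (trans (length-++ ρs) (+-comm (length ρs) 1)) (input-table πs (ρs ++ π ∷ []))
  where
  row : ∀ ρs → Row (matrix (map oneLine (ρs ++ π ∷ πs))) (length ρs) π
  row []       v = entry-tabulate _ v
  row (_ ∷ ρs) v = row ρs v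

-- Every row is copied to position `vB` and compared with the identity on the way. An identity row
-- is discarded by not advancing `vB`, so that the next row overwrites it. Equality of words is
-- tested by two inequalities.
copyCell filterRows : Program
copyCell =
  aTab [ var vB , var vU ]≔ʷ cell aPerm (var vJ) (var vU) ⨾
  ite (cell aPerm (var vJ) (var vU) ≤ʷ var vU andᵇ var vU ≤ʷ cell aPerm (var vJ) (var vU))
    skip
    (vS ≔ʷ lit 1)
filterRows =
  vB ≔ʷ lit 0 ⨾
  for vJ vA
    (vS ≔ʷ lit 0 ⨾
     for vU vN copyCell ⨾
     ite (lit 1 ≤ʷ var vS) (vB ≔ʷ succ (var vB)) skip)

filterTime : ℕ → ℕ → ℕ
filterTime n a = 2 + forTime a (2 + (forTime n 20 + 7))

module FilterRun {n : ℕ} (πs : List (Permutation′ n)) (pow : ℕ → ℤ) where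

  perm : ℕ → ℕ → ℕ
  perm = matrix (map oneLine πs)

  a : ℕ
  a = length πs

  Keep : State → Set
  Keep s = wvar s vN ≡ n × wvar s vA ≡ a × wvar s vD ≡ 0 × warr s aPerm ≡ perm
         × warr s aSel ≡ (λ _ _ → 0) × warr s aXor ≡ (λ _ _ → 0)
         × zarr s aPow ≡ pow × zvar s zAcc ≡ + 0

  Copied : State → List (Permutation′ n) → Set
  Copied s ρs = wvar s vB ≡ length ρs × Table (warr s aTab) 0 ρs

  Fixes : ℕ → ℕ → Set
  Fixes j u = perm j u ≡ u

  Copying : ℕ → ℕ → (ℕ → ℕ → ℕ) → ℕ → State → Set
  Copying j b old u s = Keep s × wvar s vJ ≡ j × wvar s vB ≡ b
    × (∀ {i} → i < b → old i ≡ warr s aTab i)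
    × (∀ {v} → v < u → warr s aTab b v ≡ perm j v)
    × ((wvar s vS ≡ 0 × (∀ {v} → v < u → Fixes j v)) ⊎ (wvar s vS ≡ 1 × ∃[ v ] (v < u × ¬ Fixes j v)))

  copyCell-run : ∀ j b old u s → u < n → wvar s vU ≡ u → wvar s vN ≡ n → Copying j b old u s →
    Run copyCell s 20 (λ s′ → wvar s′ vU ≡ u × wvar s′ vN ≡ n × Copying j b old (suc u) (setWVar vU (suc u) s′))
  copyCell-run j b old u s u<n refl N≡ (keep , refl , refl , rows , cells , flag) =
    at-most 20 (thenʷ[] (branch ≤-refl
      (λ g → at-most 2 (done (refl , N≡ , keep , refl , refl , rows′ , (λ {v} → cells′ v (v ≟ u)) ,
        fixes flag (let g₁ , g₂ = ∧-true g in ≤-antisym (≤ᵇ-true g₁) (≤ᵇ-true g₂)))))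
      (λ g → setʷ (refl , N≡ , keep , refl , refl , rows′ , (λ {v} → cells′ v (v ≟ u)) ,
        inj₂ (refl , u , ≤-refl , moved (∧-false g))))))
    where
    x : ℕ
    x = warr s aPerm j u
    perm≡ : warr s aPerm ≡ perm
    perm≡ = let _ , _ , _ , eq , _ = keep in eq
    x≡ : x ≡ perm j u
    x≡ = cong (λ f → f j u) perm≡
    tab tab′ : ℕ → ℕ → ℕ
    tab = warr s aTab
    tab′ = tab [ b ↦ tab b [ u ↦ x ] ]
    rows′ : ∀ {i} → i < b → old i ≡ tab′ i
    rows′ i<b = trans (rows i<b) (sym (update-other tab (≢-sym (<⇒≢ i<b))))
    cells′ : ∀ v → Dec (v ≡ u) → v < suc u → tab′ b v ≡ perm j v
    cells′ v v≟u v<1+u = trans (cong (λ f → f v) (update-same tab b)) (cell′ v≟u)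
      where
      cell′ : Dec (v ≡ u) → (tab b [ u ↦ x ]) v ≡ perm j v
      cell′ (yes refl) = trans (update-same (tab b) v) x≡
      cell′ (no v≢u)   = trans (update-other (tab b) (≢-sym v≢u)) (cells (≤∧≢⇒< (≤-pred v<1+u) v≢u))
    fixes : _ ⊎ _ → x ≡ u → _ ⊎ _
    fixes (inj₁ (S≡ , all)) x≡u = inj₁ (S≡ , λ {v} → all′ v (v ≟ u))
      where
      all′ : ∀ v → Dec (v ≡ u) → v < suc u → Fixes j v
      all′ v (yes refl) _ = trans (sym x≡) x≡u
      all′ v (no v≢u) v<1+u = all (≤∧≢⇒< (≤-pred v<1+u) v≢u)
    fixes (inj₂ (S≡ , v , v<u , ¬fix)) _ = inj₂ (S≡ , v , m<n⇒m<1+n v<u , ¬fix)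
    moved : (x ≤ᵇ u) ≡ false ⊎ (u ≤ᵇ x) ≡ false → ¬ Fixes j u
    moved (inj₁ g) fix = <⇒≢ (≤ᵇ-false g) (sym (trans x≡ fix))
    moved (inj₂ g) fix = <⇒≢ (≤ᵇ-false g) (trans x≡ fix)

  Filtered : State → Set
  Filtered s = Keep s × Copied s (filter moves? πs)

  filter-run : ∀ {s} → Keep s → Run filterRows s (filterTime n a) Filtered
  filter-run keep = thenʷ (weaken (λ {s} (_ , I) → exit s I)
    (for-run I refl refl step (proj₁ (proj₂ keep)) (keep , [] , πs , refl , refl , refl , tt)))
    where
    I : ℕ → State → Set
    I j s = Keep s × ∃[ ρs ] ∃[ σs ] (ρs ++ σs ≡ πs × length ρs ≡ j × Copied s (filter moves? ρs))

    step : ∀ j s → j < a → wvar s vJ ≡ j → wvar s vA ≡ a → I j s →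
           Run _ s (2 + (forTime n 20 + 7)) (λ s′ → wvar s′ vJ ≡ j × wvar s′ vA ≡ a × I (suc j) (setWVar vJ (suc j) s′))
    step j s j<a J≡ A≡ (keep , ρs , [] , eq , len , _) =
      contradiction (trans (sym len) (cong length (trans (sym (++-identityʳ ρs)) eq))) (<⇒≢ j<a)
    step j s j<a J≡ A≡ (keep , ρs , π ∷ σs , eq , refl , B≡ , table) = thenʷ
      (for-run (Copying j b (warr s aTab)) refl refl (copyCell-run j b (warr s aTab)) (proj₁ keep)
        (keep , J≡ , B≡ , (λ _ → refl) , (λ ()) , inj₁ (refl , λ ()))
       >> λ {s′} (_ , cop) → branch ≤-refl
         (λ g → kept s′ cop (≤ᵇ-true g))
         (λ g → slower (s≤s z≤n) (dropped s′ cop (≤ᵇ-false g))))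
      where
      b : ℕ
      b = length (filter moves? ρs)
      row : Row perm j π
      row = Table-++ 0 ρs (subst (Table perm 0) (sym eq) (input-table πs []))
      eq′ : (ρs ++ π ∷ []) ++ σs ≡ πs
      eq′ = trans (++-assoc ρs (π ∷ []) σs) eq
      len′ : length (ρs ++ π ∷ []) ≡ suc j
      len′ = trans (length-++ ρs) (+-comm j 1)
      Next : State → Set
      Next s′ = wvar s′ vJ ≡ j × wvar s′ vA ≡ a × I (suc j) (setWVar vJ (suc j) s′)

      kept : ∀ s′ → Copying j b (warr s aTab) n s′ → 1 ≤ wvar s′ vS → Run (vB ≔ʷ succ (var vB)) s′ 3 Next
      kept s′ (_ , _ , _ , _ , _ , inj₁ (S≡ , _)) 1≤S = contradiction (subst (1 ≤_) S≡ 1≤S) λ ()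
      kept s′ (keep , J≡ , B≡ , rows , cells , inj₂ (_ , v , v<n , ¬fix)) _ = setʷ
        (J≡ , proj₁ (proj₂ keep) , keep , ρs ++ π ∷ [] , σs , eq′ , len′ ,
         subst (λ l → suc (wvar s′ vB) ≡ length l × Table (warr s′ aTab) 0 l) (sym filter≡)
           ( trans (cong suc B≡) (sym (trans (length-++ (filter moves? ρs)) (+-comm b 1)))
           , Table-snoc 0 (filter moves? ρs) (Table-cong 0 (filter moves? ρs) rows table)
               (λ w → trans (cells (toℕ<n w)) (row w))))
        where
        moves : ¬ IsId π
        moves id = ¬fix (trans (cong (perm j) (sym (toℕ-fromℕ< v<n)))
          (trans (row (fromℕ< v<n)) (trans (cong toℕ (id (fromℕ< v<n))) (toℕ-fromℕ< v<n))))
        filter≡ : filter moves? (ρs ++ π ∷ []) ≡ filter moves? ρs ++ π ∷ []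
        filter≡ = trans (filter-++ moves? ρs (π ∷ [])) (cong (filter moves? ρs ++_) (filter-accept moves? moves))

      dropped : ∀ s′ → Copying j b (warr s aTab) n s′ → wvar s′ vS < 1 → Run skip s′ 1 Next
      dropped s′ (_ , _ , _ , _ , _ , inj₂ (S≡ , _)) S<1 = contradiction (subst (_< 1) S≡ S<1) λ { (s≤s ()) }
      dropped s′ (keep , J≡ , B≡ , rows , cells , inj₁ (_ , fixes)) _ = done
        (J≡ , proj₁ (proj₂ keep) , keep , ρs ++ π ∷ [] , σs , eq′ , len′ ,
         subst (λ l → wvar s′ vB ≡ length l × Table (warr s′ aTab) 0 l) (sym filter≡)
           (B≡ , Table-cong 0 (filter moves? ρs) rows table))
        where
        stays : ¬ ¬ IsId π
        stays ¬id = ¬id λ v → toℕ-injective (trans (sym (row v)) (fixes (toℕ<n v)))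
        filter≡ : filter moves? (ρs ++ π ∷ []) ≡ filter moves? ρs
        filter≡ = trans (filter-++ moves? ρs (π ∷ []))
          (trans (cong (filter moves? ρs ++_) (filter-reject moves? stays)) (++-identityʳ _))

    exit : ∀ s → I a s → Filtered s
    exit s (keep , ρs , [] , eq , _ , cop) =
      keep , subst (λ l → Copied s (filter moves? l)) (trans (sym (++-identityʳ ρs)) eq) cop
    exit s (keep , ρs , σ ∷ σs , eq , len , cop) = contradiction len
      (<⇒≢ (≤-trans (m<m+n (length ρs) (s≤s z≤n)) (≤-reflexive (trans (sym (length-++ ρs)) (cong length eq)))))

-- Inclusion–exclusion

total-cong : ∀ m {f g : Vec Bool m → ℤ} → (∀ xs → f xs ≡ g xs) → total m f ≡ total m g
total-cong zero    eq = eq []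
total-cong (suc m) eq = total-cong m λ xs → cong₂ ℤ._+_ (eq (false ∷ xs)) (eq (true ∷ xs))

total-minus : ∀ m (f g : Vec Bool m → ℤ) → total m (λ xs → f xs ℤ.- g xs) ≡ total m f ℤ.- total m g
total-minus zero    f g = refl
total-minus (suc m) f g = trans
  (total-cong m λ xs → rearrange (f (false ∷ xs)) (g (false ∷ xs)) (f (true ∷ xs)) (g (true ∷ xs)))
  (total-minus m (pairSum f) (pairSum g))
  where
  open +-*-Solver
  rearrange : ∀ a b c d → (a ℤ.- b) ℤ.+ (c ℤ.- d) ≡ (a ℤ.+ c) ℤ.- (b ℤ.+ d)
  rearrange = solve 4 (λ a b c d → (a :- b) :+ (c :- d) := (a :+ c) :- (b :+ d)) refl

signed-not : ∀ x m → signed (not x) m ≡ ℤ.- signed x m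
signed-not false m = refl
signed-not true  m = sym (ℤ.neg-involutive (+ m))

count : ∀ {A : Set} {P : A → Set} → Decidable P → List A → ℕ
count P? xs = length (filter P? xs)

count-cong : ∀ {A : Set} {P Q : A → Set} (P? : Decidable P) (Q? : Decidable Q) →
             (∀ {x} → P x → Q x) → (∀ {x} → Q x → P x) → ∀ xs → count P? xs ≡ count Q? xs
count-cong P? Q? to from xs = cong length (filter-≐ P? Q? (to , from) xs)

-- `R` and `S` are described by implications instead of being literally an intersection and a
-- difference, because the conjunctions to which this is applied are nested differently.
count-split : ∀ {A : Set} {P Q R S : A → Set} (P? : Decidable P) (R? : Decidable R) (S? : Decidable S) →
              Decidable Q →
              (∀ {x} → R x → P x × Q x) → (∀ {x} → P x → Q x → R x) →
              (∀ {x} → S x → P x × ¬ Q x) → (∀ {x} → P x → ¬ Q x → S x) →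
              ∀ xs → count P? xs ≡ count S? xs + count R? xs
count-split P? R? S? Q? R⇒ ⇒R S⇒ ⇒S [] = refl
count-split P? R? S? Q? R⇒ ⇒R S⇒ ⇒S (x ∷ xs)
  with ih ← count-split P? R? S? Q? R⇒ ⇒R S⇒ ⇒S xs with P? x | Q? x | R? x | S? x
... | yes p | yes q | yes r | yes s = contradiction q (proj₂ (S⇒ s))
... | yes p | yes q | yes r | no ¬s = trans (cong suc ih) (sym (+-suc _ _))
... | yes p | yes q | no ¬r | _     = contradiction (⇒R p q) ¬r
... | yes p | no ¬q | yes r | _     = contradiction (proj₂ (R⇒ r)) ¬q
... | yes p | no ¬q | no ¬r | yes s = cong suc ih
... | yes p | no ¬q | no ¬r | no ¬s = contradiction (⇒S p ¬q) ¬s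
... | no ¬p | _     | yes r | _     = contradiction (proj₁ (R⇒ r)) ¬p
... | no ¬p | _     | no ¬r | yes s = contradiction (proj₁ (S⇒ s)) ¬p
... | no ¬p | _     | no ¬r | no ¬s = ih

select : ∀ {B : Set} (ρs : List B) → Vec Bool (length ρs) → List B
select []       []           = []
select (ρ ∷ ρs) (true ∷ xs)  = ρ ∷ select ρs xs
select (ρ ∷ ρs) (false ∷ xs) = select ρs xs

module InclusionExclusion {A B : Set} {R : B → A → Set} (R? : ∀ ρ φ → Dec (R ρ φ)) (φs : List A) where

  Every None : List B → A → Set
  Every ρs φ = All (λ ρ → R ρ φ) ρs
  None ρs φ  = All (λ ρ → ¬ R ρ φ) ρs

  every? : ∀ ρs → Decidable (Every ρs)
  every? ρs φ = All.all? (λ ρ → R? ρ φ) ρs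

  none? : ∀ ρs → Decidable (None ρs)
  none? ρs φ = All.all? (λ ρ → ¬? (R? ρ φ)) ρs

  both? : ∀ {P Q : A → Set} → Decidable P → Decidable Q → Decidable (P ∩ Q)
  both? P? Q? φ = P? φ ×-dec Q? φ

  -- `P` is arbitrary for the sake of the induction: the subsets that contain the first `ρ`
  -- contribute, with opposite sign, the sum for the remaining elements with `P` restricted to
  -- `R ρ`.
  inclusion-exclusion : ∀ ρs {P : A → Set} (P? : Decidable P) →
    total (length ρs) (λ xs → signed (odd xs) (count (both? P? (every? (select ρs xs))) φs))
    ≡ + count (both? P? (none? ρs)) φs
  inclusion-exclusion []       P? = cong +_ (count-cong _ _ (λ (p , _) → p , []) (λ (p , _) → p , []) φs)
  inclusion-exclusion (ρ ∷ ρs) P? = begin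
    total m (λ xs → f xs ℤ.+ signed (not (odd xs)) (count (both? P? (every? (ρ ∷ select ρs xs))) φs))
      ≡⟨ total-cong m (λ xs → cong (λ z → f xs ℤ.+ z) (trans (signed-not (odd xs) _)
           (cong (λ c → ℤ.- signed (odd xs) c) (count-cong _ _
             (λ { (p , r ∷ rs) → (p , r) , rs }) (λ { ((p , r) , rs) → p , r ∷ rs }) φs)))) ⟩
    total m (λ xs → f xs ℤ.- g xs)
      ≡⟨ total-minus m f g ⟩
    total m f ℤ.- total m g
      ≡⟨ cong₂ ℤ._-_ (inclusion-exclusion ρs P?) (inclusion-exclusion ρs (both? P? (R? ρ))) ⟩
    + count (both? P? (none? ρs)) φs ℤ.- + count P∧ρ? φs
      ≡⟨ cong (λ c → + c ℤ.- + count P∧ρ? φs) split ⟩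
    + (count (both? P? (none? (ρ ∷ ρs))) φs + count P∧ρ? φs) ℤ.- + count P∧ρ? φs
      ≡⟨ cancel (+ count (both? P? (none? (ρ ∷ ρs))) φs) (+ count P∧ρ? φs) ⟩
    + count (both? P? (none? (ρ ∷ ρs))) φs ∎
    where
    open ≡-Reasoning
    m = length ρs
    P∧ρ? = both? (both? P? (R? ρ)) (none? ρs)
    f g : Vec Bool m → ℤ
    f xs = signed (odd xs) (count (both? P? (every? (select ρs xs))) φs)
    g xs = signed (odd xs) (count (both? (both? P? (R? ρ)) (every? (select ρs xs))) φs)
    split : count (both? P? (none? ρs)) φs ≡ count (both? P? (none? (ρ ∷ ρs))) φs + count P∧ρ? φs
    split = count-split _ _ _ (R? ρ)
      (λ { ((p , r) , rs) → (p , rs) , r }) (λ { (p , rs) r → (p , r) , rs })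
      (λ { (p , ¬r ∷ rs) → (p , rs) , ¬r }) (λ { (p , rs) ¬r → p , ¬r ∷ rs }) φs
    cancel : ∀ i j → i ℤ.+ j ℤ.- j ≡ i
    cancel i j = trans (ℤ.+-assoc i j (ℤ.- j)) (trans (cong (λ z → i ℤ.+ z) (ℤ.+-inverseʳ j)) (ℤ.+-identityʳ i))

preserves? : ∀ {n k} (π : Permutation′ n) (φ : Labeling n k) → Dec (Preserves π φ)
preserves? π φ = all? λ v → φ (π ⟨$⟩ʳ v) Finₚ.≟ φ v

module _ {n k : ℕ} where
  open InclusionExclusion {R = Preserves {n} {k}} preserves? (labelings n k) public

fixedBy : ∀ {n} → ℕ → (ρs : List (Permutation′ n)) → Vec Bool (length ρs) → ℕ
fixedBy {n} k ρs xs = count (both? (λ _ → yes tt) (every? (select ρs xs))) (labelings n k)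

-- Soundness and completeness of the list reduce the quantifier over all automorphisms to the listed
-- ones. Completeness yields a member only up to pointwise equality, so preservation has to be
-- carried over from `π` to `ρ`.
L-total : ∀ {n} (G : Graph n) k {πs} → ListsAut G πs → let ρs = filter moves? πs in
          + L G k ≡ total (length ρs) (λ xs → signed (odd xs) (fixedBy k ρs xs))
L-total {n} G k {πs} aut = trans
  (cong +_ (count-cong (distinguishing? G) (both? (λ _ → yes tt) (none? ρs)) to from (labelings n k)))
  (sym (inclusion-exclusion ρs (λ _ → yes tt)))
  where
  open ListsAut aut
  ρs : List (Permutation′ n)
  ρs = filter moves? πs
  to : ∀ {φ : Labeling n k} → Distinguishing G φ → ⊤ × None ρs φ
  to d = tt , All.tabulate λ {ρ} ρ∈ρs pres →
    let ρ∈πs , moves = ∈-filter⁻ moves? ρ∈ρs in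
    moves (d ρ (All.lookup sound ρ∈πs) pres)
  from : ∀ {φ : Labeling n k} → ⊤ × None ρs φ → Distinguishing G φ
  from {φ} (_ , none) π isAut pres v with find (complete π isAut)
  ... | ρ , ρ∈πs , π≈ρ with moves? ρ
  ...   | yes moves = contradiction
            (λ w → trans (cong φ (sym (π≈ρ w))) (pres w))
            (All.lookup none (∈-filter⁺ moves? ρ∈πs moves))
  -- `stays` is only a doubly negated `IsId`; deciding `IsId` once more removes the double negation.
  ...   | no stays with all? (λ w → ρ ⟨$⟩ʳ w Finₚ.≟ w)
  ...     | yes id = trans (π≈ρ v) (id v)
  ...     | no ¬id = contradiction ¬id stays

-- Labelings constant on the components

funToFin-cong : ∀ {m n} {f g : Fin m → Fin n} → f ≗ g → funToFin f ≡ funToFin g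
funToFin-cong {zero}  _  = refl
funToFin-cong {suc m} eq = cong₂ combine (eq Fin.zero) (funToFin-cong (eq ∘ Fin.suc))

-- Labelings constant on the fibres of `comp` correspond to maps on the `c` components: compose with
-- `root` in one direction and with `comp` in the other. On codes in `Fin` this gives two
-- repetition-free lists with the same members, hence of equal length, and functions never have to
-- be compared for equality.
count-constant : ∀ {n k c} (comp : Fin n → Fin c) (root : Fin c → Fin n) → (∀ i → comp (root i) ≡ i) →
                 {P : Labeling n k → Set} (P? : Decidable P) →
                 (∀ {φ} → P φ → ∀ v → φ v ≡ φ (root (comp v))) →
                 (∀ {φ} → (∀ v → φ v ≡ φ (root (comp v))) → P φ) →
                 count P? (labelings n k) ≡ k ^ c
count-constant {n} {k} {c} comp root comp-root {P} P? to from = begin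
  count P? (map finToFun (allFin (k ^ n)))  ≡⟨ count-map (allFin (k ^ n)) ⟩
  length (filter Q? (allFin (k ^ n)))       ≡⟨ ↭-length (∼bag⇒↭ (unique∧set⇒bag
                                                 (Unique.filter⁺ Q? (Unique.allFin⁺ (k ^ n)))
                                                 (Unique.map⁺ g-injective (Unique.allFin⁺ (k ^ c)))
                                                 (mk⇔ ⇒ ⇐))) ⟩
  length (map g (allFin (k ^ c)))           ≡⟨ length-map g (allFin (k ^ c)) ⟩
  length (allFin (k ^ c))                   ≡⟨ length-tabulate id ⟩
  k ^ c                                     ∎
  where
  open ≡-Reasoning
  Q? : Decidable (P ∘ finToFun)
  Q? i = P? (finToFun i)
  count-map : ∀ is → count P? (map finToFun is) ≡ length (filter Q? is)
  count-map []       = refl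
  count-map (i ∷ is) with P? (finToFun i)
  ... | yes _ = cong suc (count-map is)
  ... | no _  = count-map is
  g : Fin (k ^ c) → Fin (k ^ n)
  g i = funToFin (finToFun i ∘ comp)
  g-injective : ∀ {i j} → g i ≡ g j → i ≡ j
  g-injective {i} {j} eq = trans (sym (funToFin-finToFin {c} {k} i)) (trans (funToFin-cong same) (funToFin-finToFin {c} {k} j))
    where
    same : finToFun {k} {c} i ≗ finToFun j
    same x = begin
      finToFun i x                                 ≡⟨ cong (finToFun i) (sym (comp-root x)) ⟩
      finToFun i (comp (root x))                   ≡⟨ sym (finToFun-funToFin (finToFun i ∘ comp) (root x)) ⟩
      finToFun (g i) (root x)                      ≡⟨ cong (λ y → finToFun y (root x)) eq ⟩
      finToFun (g j) (root x)                      ≡⟨ finToFun-funToFin (finToFun j ∘ comp) (root x) ⟩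
      finToFun j (comp (root x))                   ≡⟨ cong (finToFun j) (comp-root x) ⟩
      finToFun j x                                 ∎
  ⇒ : ∀ {i} → i ∈ filter Q? (allFin (k ^ n)) → i ∈ map g (allFin (k ^ c))
  ⇒ {i} i∈ = subst (_∈ map g (allFin (k ^ c))) g≡i (∈-map⁺ g (∈-allFin (funToFin (φ ∘ root))))
    where
    φ : Labeling n k
    φ = finToFun i
    g≡i : g (funToFin (φ ∘ root)) ≡ i
    g≡i = trans (funToFin-cong λ v → trans (finToFun-funToFin (φ ∘ root) (comp v))
                                       (sym (to (proj₂ (∈-filter⁻ Q? {xs = allFin (k ^ n)} i∈)) v)))
                (funToFin-finToFin {n} {k} i)
  ⇐ : ∀ {i} → i ∈ map g (allFin (k ^ c)) → i ∈ filter Q? (allFin (k ^ n))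
  ⇐ i∈ with ∈-map⁻ g i∈
  ... | j , _ , refl = ∈-filter⁺ Q? (∈-allFin (g j)) (from λ v → begin
    finToFun (g j) v                      ≡⟨ finToFun-funToFin (finToFun j ∘ comp) v ⟩
    finToFun j (comp v)                   ≡⟨ cong (finToFun j) (sym (comp-root (comp v))) ⟩
    finToFun j (comp (root (comp v)))     ≡⟨ sym (finToFun-funToFin (finToFun j ∘ comp) (root (comp v))) ⟩
    finToFun (g j) (root (comp v))        ∎)

-- Some power of a permutation of a finite set fixes any given point.
closed-under-inverse : ∀ {n} (π : Permutation′ n) (A : Fin n → Set) →
                       (∀ {v} → A v → A (π ⟨$⟩ʳ v)) → ∀ {v} → A (π ⟨$⟩ʳ v) → A v
closed-under-inverse {n} π A step {v} a with pigeonhole (n<1+n n) (λ i → fold v (π ⟨$⟩ʳ_) (toℕ i))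
... | i , j , i<j , eq = let m , v≡ = cycle (toℕ i) (toℕ j) i<j eq in subst A (sym v≡) (orbit m)
  where
  injective : ∀ {x y} → π ⟨$⟩ʳ x ≡ π ⟨$⟩ʳ y → x ≡ y
  injective eq = trans (sym (inverseˡ π)) (trans (cong (π ⟨$⟩ˡ_) eq) (inverseˡ π))
  cycle : ∀ i j → i < j → fold v (π ⟨$⟩ʳ_) i ≡ fold v (π ⟨$⟩ʳ_) j → ∃[ m ] v ≡ fold v (π ⟨$⟩ʳ_) (suc m)
  cycle zero    (suc j) _         eq = j , eq
  cycle (suc i) (suc j) (s≤s i<j) eq = cycle i j i<j (injective eq)
  orbit : ∀ m → A (fold v (π ⟨$⟩ʳ_) (suc m))
  orbit zero    = a
  orbit (suc m) = step (orbit m)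

row-at : ∀ {n f} o (ρs : List (Permutation′ n)) → Table f o ρs →
         ∀ {i} → o ≤ i → i < o + length ρs → ∃[ ρ ] Row {n} f i ρ
row-at o [] _ o≤i i<o = contradiction (subst (_ <_) (+-identityʳ o) i<o) (≤⇒≯ o≤i)
row-at o (ρ ∷ ρs) (r , t) {i} o≤i i< with o ≟ i
... | yes refl = ρ , r
... | no o≢i   = row-at (suc o) ρs t (≤∧≢⇒< o≤i o≢i) (subst (i <_) (+-suc o _) i<)

-- The search sees a subset as the rows with a non-zero digit, inclusion-exclusion sees it as
-- `select`. This lemma and `selected-row` translate between the two.
row-selected : ∀ {n f sel} o (ρs : List (Permutation′ n)) {xs} → Table f o ρs → Digits sel o xs →
               ∀ {i} → o ≤ i → i < o + length ρs → 1 ≤ sel i → ∃[ ρ ] (ρ ∈ select ρs xs × Row f i ρ)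
row-selected o [] _ _ o≤i i<o _ = contradiction (subst (_ <_) (+-identityʳ o) i<o) (≤⇒≯ o≤i)
row-selected o (ρ ∷ ρs) {x ∷ xs} (r , t) (d , ds) {i} o≤i i< on with o ≟ i
row-selected o (ρ ∷ ρs) {true ∷ xs}  (r , t) (d , ds) o≤i i< on | yes refl = ρ , here refl , r
row-selected o (ρ ∷ ρs) {false ∷ xs} (r , t) (d , ds) o≤i i< on | yes refl =
  contradiction (subst (1 ≤_) d on) λ ()
row-selected o (ρ ∷ ρs) {x ∷ xs} (r , t) (d , ds) {i} o≤i i< on | no o≢i
  with row-selected (suc o) ρs t ds (≤∧≢⇒< o≤i o≢i) (subst (i <_) (+-suc o _) i<) on
row-selected o (ρ ∷ ρs) {true ∷ xs}  _ _ _ _ _ | no _ | ρ′ , ρ′∈ , r′ = ρ′ , there ρ′∈ , r′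
row-selected o (ρ ∷ ρs) {false ∷ xs} _ _ _ _ _ | no _ | ρ′ , ρ′∈ , r′ = ρ′ , ρ′∈ , r′

selected-row : ∀ {n f sel} o (ρs : List (Permutation′ n)) xs → Table f o ρs → Digits sel o xs →
               All (λ ρ → ∃[ i ] (i < o + length ρs × 1 ≤ sel i × Row f i ρ)) (select ρs xs)
selected-row o []       []       _       _        = []
selected-row {sel = sel} o (ρ ∷ ρs) (x ∷ xs) (r , t) (d , ds) = head x d
  (All.map (λ { (i , i< , rest) → i , subst (i <_) (sym (+-suc o _)) i< , rest })
    (selected-row (suc o) ρs xs t ds))
  where
  head : ∀ x → sel o ≡ bit x → All _ (select ρs xs) → All _ (select (ρ ∷ ρs) (x ∷ xs))
  head true  d rest = (o , m<m+n o (s≤s z≤n) , ≤-reflexive (sym d) , r) ∷ rest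
  head false d rest = rest

module _ {n : ℕ} (ρs : List (Permutation′ n)) (tab : ℕ → ℕ → ℕ) (table : Table tab 0 ρs) where

  private
    b : ℕ
    b = length ρs

    row-fromℕ< : ∀ {i u} {ρ : Permutation′ n} → Row tab i ρ → (u<n : u < n) → tab i u ≡ toℕ (ρ ⟨$⟩ʳ fromℕ< u<n)
    row-fromℕ< {i} {ρ = ρ} row u<n = trans (cong (tab i) (sym (toℕ-fromℕ< u<n))) (row (fromℕ< u<n))

  table-< : ∀ {i u} → i < b → u < n → tab i u < n
  table-< i<b u<n with row-at 0 ρs table z≤n i<b
  ... | ρ , row = subst (_< n) (sym (row-fromℕ< {ρ = ρ} row u<n)) (toℕ<n _)

  table-back : ∀ {i} → i < b → (A : ℕ → Set) → (∀ {u} → u < n → A u → A (tab i u)) →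
               ∀ {u} → u < n → A (tab i u) → A u
  table-back i<b A step u<n a with row-at 0 ρs table z≤n i<b
  ... | ρ , row = subst A (toℕ-fromℕ< u<n) (closed-under-inverse ρ (A ∘ toℕ)
    (λ {v} Av → subst A (row v) (step (toℕ<n v) Av))
    (subst A (row-fromℕ< {ρ = ρ} row u<n) a))

  module _ {k : ℕ} {xs : Vec Bool b} {sel : ℕ → ℕ} {M : ℕ → ℕ} {c : ℕ} (digits : Digits sel 0 xs) where
    open GraphSearch n b tab sel table-< table-back using (Invariant; Components; module Components)

    -- The marks, shifted down by one, map the vertices onto `Fin c`. A labeling preserved by the
    -- selected permutations is an invariant function, so `connected` makes it constant on
    -- components; the converse is the invariance of `M` itself.
    fixedBy-components : Components M c → fixedBy k ρs xs ≡ k ^ c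
    fixedBy-components comps = count-constant comp root comp-root
      (both? (λ _ → yes tt) (every? (select ρs xs))) to from
      where
      open Components comps
      pred< : ∀ {m} → 1 ≤ m → m ≤ c → pred m < c
      pred< (s≤s _) m≤c = m≤c
      comp : Fin n → Fin c
      comp v = fromℕ< (pred< (M≥1 (toℕ<n v)) (M≤ (toℕ<n v)))
      suc-comp : ∀ v → suc (toℕ (comp v)) ≡ M (toℕ v)
      suc-comp v = trans (cong suc (toℕ-fromℕ< _)) (suc-pred (M (toℕ v)) {{>-nonZero (M≥1 (toℕ<n v))}})
      rootOf : ∀ i → ∃[ r ] (r < n × M r ≡ suc (toℕ i))
      rootOf i = surj (s≤s z≤n) (toℕ<n i)
      root : Fin c → Fin n
      root i = fromℕ< (proj₁ (proj₂ (rootOf i)))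
      M-root : ∀ i → M (toℕ (root i)) ≡ suc (toℕ i)
      M-root i = trans (cong M (toℕ-fromℕ< _)) (proj₂ (proj₂ (rootOf i)))
      comp-root : ∀ i → comp (root i) ≡ i
      comp-root i = toℕ-injective (suc-injective (trans (suc-comp (root i)) (M-root i)))

      to : ∀ {φ : Labeling n k} → ⊤ × Every (select ρs xs) φ → ∀ v → φ v ≡ φ (root (comp v))
      to {φ} (_ , every) v = toℕ-injective (trans (sym (ext-toℕ v)) (trans
        (connected (toℕ<n v) (toℕ<n (root (comp v))) (trans (sym (suc-comp v)) (sym (M-root (comp v)))) ext inv)
        (ext-toℕ (root (comp v)))))
        where
        -- `Connected` quantifies over functions on all of ℕ, so the labeling is extended by 0. Only
        -- its values below `n` are ever compared.
        ext : ℕ → ℕ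
        ext u with u <? n
        ... | yes u<n = toℕ (φ (fromℕ< u<n))
        ... | no _    = 0
        ext-toℕ : ∀ v → ext (toℕ v) ≡ toℕ (φ v)
        ext-toℕ v with toℕ v <? n
        ... | yes v<n = cong (toℕ ∘ φ) (fromℕ<-toℕ v v<n)
        ... | no v≮n  = contradiction (toℕ<n v) v≮n
        inv : Invariant ext
        inv {i} {u} i<b on u<n with row-selected 0 ρs table digits z≤n i<b on
        ... | ρ , ρ∈ , row = begin
          ext (tab i u)             ≡⟨ cong ext (row-fromℕ< {ρ = ρ} row u<n) ⟩
          ext (toℕ (ρ ⟨$⟩ʳ w))      ≡⟨ ext-toℕ (ρ ⟨$⟩ʳ w) ⟩
          toℕ (φ (ρ ⟨$⟩ʳ w))        ≡⟨ cong toℕ (All.lookup every ρ∈ w) ⟩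
          toℕ (φ w)                 ≡⟨ sym (ext-toℕ w) ⟩
          ext (toℕ w)               ≡⟨ cong ext (toℕ-fromℕ< u<n) ⟩
          ext u                     ∎
          where
          open ≡-Reasoning
          w = fromℕ< u<n

      from : ∀ {φ : Labeling n k} → (∀ v → φ v ≡ φ (root (comp v))) → ⊤ × Every (select ρs xs) φ
      from {φ} const = tt , All.map (λ {ρ} → pres ρ) (selected-row 0 ρs xs table digits)
        where
        pres : ∀ ρ → ∃[ i ] (i < b × 1 ≤ sel i × Row tab i ρ) → Preserves ρ φ
        pres ρ (i , i<b , on , row) v = trans (const (ρ ⟨$⟩ʳ v))
          (trans (cong (φ ∘ root) same) (sym (const v)))
          where
          same : comp (ρ ⟨$⟩ʳ v) ≡ comp v
          same = toℕ-injective (suc-injective (trans (suc-comp (ρ ⟨$⟩ʳ v))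
            (trans (cong M (sym (row v))) (trans (invariant i<b on (toℕ<n v)) (sym (suc-comp v))))))

-- Bit lengths

≤power⇒log≤ : ∀ {m e} → m ≤ 2 ^ e → ⌊log₂ m ⌋ ≤ e
≤power⇒log≤ {e = e} p = subst (_ ≤_) (⌊log₂[2^n]⌋≡n e) (⌊log₂⌋-mono-≤ p)

between-powers : ∀ k → 1 ≤ k → ∃[ m ] (2 ^ m ≤ k × k < 2 ^ suc m)
between-powers (suc zero) _ = 0 , ≤-refl , ≤-refl
between-powers (suc k@(suc _)) _ with between-powers k (s≤s z≤n)
... | m , 2^m≤k , k<2^1+m with suc k <? 2 ^ suc m
...   | yes k+1< = m , m≤n⇒m≤1+n 2^m≤k , k+1<
...   | no k+1≮ = suc m , ≮⇒≥ k+1≮ ,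
        ≤-<-trans k<2^1+m (m<m*n (2 ^ suc m) 2 {{m^n≢0 2 (suc m)}} (s≤s (s≤s z≤n)) ⟨<≡⟩ *-comm (2 ^ suc m) 2)
  where
  _⟨<≡⟩_ : ∀ {x y z} → x < y → y ≡ z → x < z
  x<y ⟨<≡⟩ refl = x<y

-- The exponent is doubled, not increased by one, so that it vanishes for k = 1. With one more than
-- the logarithm, `k ^ n` would be granted n bits even there and the table of powers n² time, which
-- the claimed bound does not contain.
≤power-2log : ∀ k → 1 ≤ k → k ≤ 2 ^ (2 * ⌊log₂ k ⌋)
≤power-2log k 1≤k with between-powers k 1≤k
... | zero  , _    , k<2 = ≤-trans (≤-pred k<2) (m^n>0 2 (2 * ⌊log₂ k ⌋))
... | suc m , 2^m≤ , k<  = ≤-trans (<⇒≤ k<) (^-monoʳ-≤ 2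
  (≤-trans (+-monoʳ-≤ 1 (m≤n+m (suc m) m)) (≤-trans (≤-reflexive (lemma m)) (*-monoʳ-≤ 2 (power≤⇒≤log 2^m≤)))))
  where
  lemma : ∀ m → 1 + (m + suc m) ≡ 2 * suc m
  lemma = solve-∀

module _ (n k : ℕ) (1≤k : 1 ≤ k) where

  power-bound : k ^ n ≤ 2 ^ (2 * (n * ⌊log₂ k ⌋))
  power-bound = ≤-trans (^-monoˡ-≤ n (≤power-2log k 1≤k))
    (≤-reflexive (trans (^-*-assoc 2 (2 * ⌊log₂ k ⌋) n) (cong (2 ^_) (lemma n ⌊log₂ k ⌋))))
    where
    lemma : ∀ n l → 2 * l * n ≡ 2 * (n * l)
    lemma = solve-∀

  scaled-bits : ∀ e z → ∣ z ∣ ≤ 2 ^ e * k ^ n → bits z ≤ suc (e + 2 * (n * ⌊log₂ k ⌋))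
  scaled-bits e z z≤ = s≤s (≤power⇒log≤ (≤-trans z≤ (≤-trans (*-monoʳ-≤ (2 ^ e) power-bound)
    (≤-reflexive (sym (^-distribˡ-+-* 2 e (2 * (n * ⌊log₂ k ⌋))))))))

-- The assembled program and its correctness.

program : Program
program =
  powersOfTwo ⨾ powersOfK ⨾ filterRows ⨾
  aXor [ lit 0 , lit 1 ]≔ʷ lit 1 ⨾
  aXor [ lit 1 , lit 0 ]≔ʷ lit 1 ⨾
  mainLoop ⨾
  zK ≔ᶻ var zAcc

-- `Z` and `W` are the bit bounds of `scaled-bits` with exponents 1 and `b`: for numbers up to
-- `2 * k ^ n` in the table of powers, and up to `2 ^ b * k ^ n` in the sum.
programTime : ℕ → ℕ → ℕ → ℕ → ℕ
programTime n a b l = let Z = suc (1 + 2 * (n * l)) ; W = suc (b + 2 * (n * l)) in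
  twoTime l Z + (powerTime n l Z + (filterTime n a + (4 + (4 + (mainTime n b W + (1 + W))))))

L≤ : ∀ {n} (G : Graph n) k → L G k ≤ k ^ n
L≤ {n} G k = ≤-trans (length-filter (distinguishing? G) (labelings n k))
  (≤-reflexive (trans (length-map _ (allFin (k ^ n))) (length-tabulate id)))

program-run : ∀ {n} (G : Graph n) k πs → 1 ≤ n → 1 ≤ k → ListsAut G πs →
              Run program (input G k πs)
                (programTime n (length πs) (length (filter moves? πs)) ⌊log₂ k ⌋)
                (λ s → output s ≡ + L G k)
program-run {n} G k πs 1≤n 1≤k aut =
  twos-run (refl , refl , refl , refl , refl , refl) >>
  λ {s} (keep , m , m≤ , k< , twos) → powers-run m m≤ k< {s} keep twos >>
  λ {s} → summing s {m} {m≤} {k<}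
  where
  open PowerRun n k 1≤n 1≤k (suc (1 + 2 * (n * ⌊log₂ k ⌋))) (λ m → scaled-bits n k 1≤k 1 (+ m))
                (length πs) (warr (input G k πs))
  ρs : List (Permutation′ n)
  ρs = filter moves? πs
  b W : ℕ
  b = length ρs
  W = suc (b + 2 * (n * ⌊log₂ k ⌋))

  small-bits : ∀ z → ∣ z ∣ ≤ 2 ^ b * k ^ n → bits z ≤ W
  small-bits = scaled-bits n k 1≤k b

  final : ∀ s → zvar s zAcc ≡ + L G k → Run (zK ≔ᶻ var zAcc) s (1 + W) (λ s → output s ≡ + L G k)
  final s eq = setᶻ (subst (λ z → bits z ≤ W) (sym eq) (small-bits (+ L G k)
    (≤-trans (L≤ G k) (m≤n*m (k ^ n) (2 ^ b) {{m^n≢0 2 b}})))) eq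

  xor-initialised : ∀ {X : ℕ → ℕ → ℕ} → X ≡ (λ _ _ → 0) → ∀ i j →
                    (X [ 0 ↦ X 0 [ 1 ↦ 1 ] ] [ 1 ↦ (X [ 0 ↦ X 0 [ 1 ↦ 1 ] ]) 1 [ 0 ↦ 1 ] ]) i j ≡ xorTable i j
  xor-initialised refl i j = refl

  summing : ∀ s → ∀ {m} {m≤ : m ≤ suc ⌊log₂ k ⌋} {k< : k < 2 ^ m} → Powers m m≤ k< n s →
            Run (filterRows ⨾ aXor [ lit 0 , lit 1 ]≔ʷ lit 1 ⨾ aXor [ lit 1 , lit 0 ]≔ʷ lit 1 ⨾
                 mainLoop ⨾ zK ≔ᶻ var zAcc) s
              (filterTime n (length πs) + (4 + (4 + (mainTime n b W + (1 + W)))))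
              (λ s → output s ≡ + L G k)
  summing s ((N≡ , A≡ , D≡ , words≡ , K≡ , acc≡) , _ , pows) =
    FilterRun.filter-run πs (zarr s aPow)
      (N≡ , A≡ , D≡ , cong (λ w → w aPerm) words≡ , cong (λ w → w aSel) words≡ ,
       cong (λ w → w aXor) words≡ , refl , acc≡) >>
    λ {s} ((N≡ , A≡ , D≡ , _ , sel≡ , xor≡ , pow≡ , acc≡) , B≡ , table) → thenʷ[] (thenʷ[]
      (MainRun.main-run n b (warr s aTab) (table-< ρs _ table) (table-back ρs _ table) _ k 1≤k
         pows (fixedBy k ρs) (fixedBy≤ k ρs)
         (λ {xs} digits comps → fixedBy-components ρs (warr s aTab) table {xs = xs} digits comps) W small-bits
         (context N≡ B≡ D≡ refl refl (xor-initialised xor≡) pow≡ acc≡)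
         (λ i → cong (λ f → f 0 i) sel≡) >>
       λ {s} eq → final s (trans eq (sym (L-total G k aut)))))
    where
    fixedBy≤ : ∀ k (ρs : List (Permutation′ n)) xs → fixedBy k ρs xs ≤ k ^ n
    fixedBy≤ k ρs xs = ≤-trans (length-filter _ (labelings n k))
      (≤-reflexive (trans (length-map _ (allFin (k ^ n))) (length-tabulate id)))

-- The running time

-- The local `expand` restates the claim with `twoTime` unfolded, as a polynomial identity for the
-- ring solver; the two statements agree by computation. The expansions below work the same way.
twoTime-expand : ∀ n l → twoTime l (suc (1 + 2 * (n * l))) ≡ 35 + 22 * l + 18 * (n * l) + 12 * (n * (l * l))
twoTime-expand = expand
  where
  expand : ∀ n l → let Z = 2 + 2 * (n * l) in
    3 + (2 + ((1 + l) * (1 + (1 + Z + Z + Z) + (3 + ((1 + Z) + (1 + Z) + Z) + 3)) + (1 + (1 + Z + Z + Z))))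
    ≡ 35 + 22 * l + 18 * (n * l) + 12 * (n * (l * l))
  expand = solve-∀

powerTime-expand : ∀ n l → powerTime n l (suc (1 + 2 * (n * l))) ≡
                   10 + 62 * n + 38 * (n * l) + 28 * (n * n * l) + 24 * (n * n * (l * l))
powerTime-expand = expand
  where
  expand : ∀ n l → let
    Z = 2 + 2 * (n * l)
    M = 3 + (1 + (Z + Z + Z) + (1 + (1 + Z + Z + Z) + (1 + (Z + (1 + Z) + Z) + (1 + (Z + (1 + Z) + Z)))))
    T = 2 + (1 + Z + (2 + ((1 + l) * (1 + 3 + M) + (1 + 3) + (3 + Z))))
    in 3 + (2 + (n * (5 + (T + 3)) + 5))
       ≡ 10 + 62 * n + 38 * (n * l) + 28 * (n * n * l) + 24 * (n * n * (l * l))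
  expand = solve-∀

filterTime-expand : ∀ n a → filterTime n a ≡ 9 + 24 * a + 28 * (n * a)
filterTime-expand = expand
  where
  expand : ∀ n a → 2 + (2 + (a * (5 + ((2 + ((2 + (n * (5 + (20 + 3)) + 5)) + 7)) + 3)) + 5)) ≡ 9 + 24 * a + 28 * (n * a)
  expand = solve-∀

roundTime-expand : ∀ n b l → roundTime n b (suc (b + 2 * (n * l))) ≡
                   64 + 126 * n + 35 * b + 76 * (n * b) + 6 * (n * l)
roundTime-expand = expand
  where
  expand : ∀ n b l → let
    W = 1 + (b + 2 * (n * l))
    S = 8 + ((n + n) * (9 + (4 + (4 + (2 + (b * (5 + (30 + 3)) + 5)) + 3 + 30))) + 9)
    in (2 + (n * (5 + (4 + 3)) + 5)) + ((2 + (2 + (b * (5 + (6 + 3)) + 5))) + (S +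
         ((4 + (1 + (W + (1 + W) + W))) + (2 + ((b * (11 + 7) + 11) + 9)))))
       ≡ 64 + 126 * n + 35 * b + 76 * (n * b) + 6 * (n * l)
  expand = solve-∀

infix  4 _≤_·_
infixl 6 _⊞_

-- An estimate O(U) with explicit constant, wrapped in a record so that `c` and `U` can be inferred:
-- for a numeral `c`, the product `c * U` would unfold into a sum.
record _≤_·_ (x c U : ℕ) : Set where
  constructor bounded
  field unbounded : x ≤ c * U
open _≤_·_

scale : ∀ c {m U} → m ≤ U → c * m ≤ c · U
scale c m≤U = bounded (*-monoʳ-≤ c m≤U)

unit : ∀ {m U} → m ≤ U → m ≤ 1 · U
unit {U = U} m≤U = bounded (≤-trans m≤U (≤-reflexive (sym (*-identityˡ U))))

constant : ∀ c {U} → 1 ≤ U → c ≤ c · U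
constant c {U} 1≤U = bounded (m≤m*n c U {{>-nonZero 1≤U}})

_⊞_ : ∀ {x y c d U} → x ≤ c · U → y ≤ d · U → x + y ≤ (c + d) · U
_⊞_ {c = c} {d} {U} (bounded p) (bounded q) =
  bounded (≤-trans (+-mono-≤ p q) (≤-reflexive (sym (*-distribʳ-+ U c d))))

expanded : ∀ {x y c U} → x ≡ y → y ≤ c · U → x ≤ c · U
expanded refl y≤ = y≤

bound : ℕ → ℕ → ℕ → ℕ
bound n l a = n ^ 2 * l ^ 2 + 2 ^ a * (n * a + n * l)

-- One summand for each part of the program, nested as in `programTime`; each is the sum of the
-- coefficients of the expanded polynomial. 315 is 311 for the rounds plus 4 for the final test of
-- the main loop.
timeConstant : ℕ
timeConstant = 87 + (162 + (61 + (4 + (4 + (315 + 5)))))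

-- As `a` is positive, n a absorbs the constants and the terms linear in n even if `l` is 0. Mixed
-- terms such as n² l are absorbed by n² l², because l is at most l². A round is measured in units
-- of `V`, to be multiplied by the number of rounds.
programTime≤ : ∀ n a b l → 1 ≤ n → 1 ≤ a → b ≤ a → programTime n a b l ≤ timeConstant * bound n l a
programTime≤ n a b l 1≤n 1≤a b≤a = unbounded
  (two ⊞ (pow ⊞ (rows ⊞ (constant 4 1≤U ⊞ (constant 4 1≤U ⊞ ((rounds ⊞ constant 4 1≤U) ⊞ last))))))
  where
  instance
    n≢0 : NonZero n
    n≢0 = >-nonZero 1≤n
    a≢0 : NonZero a
    a≢0 = >-nonZero 1≤a
    E≢0 : NonZero (2 ^ a)
    E≢0 = m^n≢0 2 a
  U V : ℕ
  U = bound n l a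
  V = n * a + n * l
  EV≤U : 2 ^ a * V ≤ U
  EV≤U = m≤n+m (2 ^ a * V) (n ^ 2 * l ^ 2)
  V≤U : V ≤ U
  V≤U = ≤-trans (m≤n*m V (2 ^ a)) EV≤U
  na≤V : n * a ≤ V
  na≤V = m≤m+n (n * a) (n * l)
  nl≤V : n * l ≤ V
  nl≤V = m≤n+m (n * l) (n * a)
  n≤V : n ≤ V
  n≤V = ≤-trans (m≤m*n n a) na≤V
  a≤V : a ≤ V
  a≤V = ≤-trans (m≤n*m a n) na≤V
  1≤V : 1 ≤ V
  1≤V = ≤-trans 1≤n n≤V
  1≤U : 1 ≤ U
  1≤U = ≤-trans 1≤V V≤U
  nl≤U : n * l ≤ U
  nl≤U = ≤-trans nl≤V V≤U
  l≤U : l ≤ U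
  l≤U = ≤-trans (m≤n*m l n) nl≤U
  l≤l*l : ∀ l → l ≤ l * l
  l≤l*l zero      = z≤n
  l≤l*l l@(suc _) = m≤m*n l l
  n²l²≤U : n * n * (l * l) ≤ U
  n²l²≤U = ≤-trans (≤-reflexive (cong₂ _*_ (square n) (square l))) (m≤m+n _ (2 ^ a * V))
    where
    square : ∀ m → m * m ≡ m ^ 2
    square m = cong (m *_) (sym (*-identityʳ m))
  n²l≤U : n * n * l ≤ U
  n²l≤U = ≤-trans (*-monoʳ-≤ (n * n) (l≤l*l l)) n²l²≤U
  nl²≤U : n * (l * l) ≤ U
  nl²≤U = ≤-trans (*-monoˡ-≤ (l * l) (m≤m*n n n)) n²l²≤U
  two : twoTime l (suc (1 + 2 * (n * l))) ≤ 87 · U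
  two = expanded (twoTime-expand n l)
    (constant 35 1≤U ⊞ scale 22 l≤U ⊞ scale 18 nl≤U ⊞ scale 12 nl²≤U)
  pow : powerTime n l (suc (1 + 2 * (n * l))) ≤ 162 · U
  pow = expanded (powerTime-expand n l)
    (constant 10 1≤U ⊞ scale 62 (≤-trans n≤V V≤U) ⊞ scale 38 nl≤U ⊞ scale 28 n²l≤U ⊞ scale 24 n²l²≤U)
  rows : filterTime n a ≤ 61 · U
  rows = expanded (filterTime-expand n a)
    (constant 9 1≤U ⊞ scale 24 (≤-trans a≤V V≤U) ⊞ scale 28 (≤-trans na≤V V≤U))
  oneRound : 4 + roundTime n b (suc (b + 2 * (n * l))) ≤ 311 · V
  oneRound = constant 4 1≤V ⊞ expanded (roundTime-expand n b l)
    (constant 64 1≤V ⊞ scale 126 n≤V ⊞ scale 35 (≤-trans b≤a a≤V)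
       ⊞ scale 76 (≤-trans (*-monoʳ-≤ n b≤a) na≤V) ⊞ scale 6 nl≤V)
  swap : ∀ x y z → x * (y * z) ≡ y * (x * z)
  swap = solve-∀
  rounds : 2 ^ b * (4 + roundTime n b (suc (b + 2 * (n * l)))) ≤ 311 · U
  rounds = bounded (≤-trans (*-mono-≤ (^-monoʳ-≤ 2 b≤a) (unbounded oneRound))
    (≤-trans (≤-reflexive (swap (2 ^ a) 311 V)) (*-monoʳ-≤ 311 EV≤U)))
  last : 1 + suc (b + 2 * (n * l)) ≤ 5 · U
  last = constant 2 1≤U ⊞ (unit (≤-trans b≤a (≤-trans a≤V V≤U)) ⊞ scale 2 nl≤U)

aut-nonempty : ∀ {n} {G : Graph n} {πs} → ListsAut G πs → 1 ≤ length πs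
aut-nonempty aut with ListsAut.complete aut Perm.id (λ _ _ → refl)
... | here _  = s≤s z≤n
... | there _ = s≤s z≤n

computes : ∀ (𝒢 : GraphClass) → ComputesLWithin program 𝒢 (λ n k a → timeConstant * bound n ⌊log₂ k ⌋ a)
computes 𝒢 {n} G k πs 1≤n 1≤k _ aut = result (program-run G k πs 1≤n 1≤k aut)
  (programTime≤ n (length πs) (length (filter moves? πs)) ⌊log₂ k ⌋ 1≤n (aut-nonempty aut) (length-filter moves? πs))

-- Logarithmically many automorphisms

log≤ : ∀ m {n} → n < 2 ^ suc m → ⌊log₂ n ⌋ ≤ m
log≤ zero    {zero}        _               = z≤n
log≤ zero    {suc zero}    _               = z≤n
log≤ zero    {suc (suc _)} (s≤s (s≤s ()))
log≤ (suc m) {n} n< = ≤-trans (m≤n+m∸n ⌊log₂ n ⌋ 1) (s≤s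
  (subst (_≤ m) (⌊log₂⌊n/2⌋⌋≡⌊log₂n⌋∸1 n) (log≤ m (≰⇒> λ p≤ → <⇒≱ n< (begin
    2 * p                 ≡⟨ cong (λ z → p + z) (+-identityʳ p) ⟩
    p + p                 ≤⟨ +-mono-≤ p≤ (≤-trans p≤ (⌊n/2⌋≤⌈n/2⌉ n)) ⟩
    ⌊ n /2⌋ + ⌈ n /2⌉     ≡⟨ ⌊n/2⌋+⌈n/2⌉≡n n ⟩
    n                     ∎)))))
  where
  open ≤-Reasoning
  p : ℕ
  p = 2 ^ suc m

2^log≤ : ∀ n → 1 ≤ n → 2 ^ ⌊log₂ n ⌋ ≤ n
2^log≤ n 1≤n with between-powers n 1≤n
... | m , 2^m≤n , n< = ≤-trans (^-monoʳ-≤ 2 (log≤ m n<)) 2^m≤n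

n≤2^n : ∀ n → n ≤ 2 ^ n
n≤2^n zero    = z≤n
n≤2^n (suc n) = ≤-trans (+-mono-≤ (m^n>0 2 n) (n≤2^n n)) (≤-reflexive (cong (λ z → 2 ^ n + z) (sym (+-identityʳ (2 ^ n)))))

AllPairs-lookup : ∀ {A : Set} {R : A → A → Set} {xs : List A} → AllPairs R xs →
                  ∀ {i j} → i Fin.< j → R (lookup xs i) (lookup xs j)
AllPairs-lookup (r ∷ _)  {Fin.zero}  {Fin.suc j} _         = All.lookup r (∈-lookup j)
AllPairs-lookup (_ ∷ rs) {Fin.suc i} {Fin.suc j} (s≤s i<j) = AllPairs-lookup rs i<j

-- Distinct permutations have distinct codes in `Fin (n ^ n)`. So crude a bound suffices, for it
-- only serves the finitely many `n` below a fixed threshold.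
aut≤ : ∀ {n} {G : Graph n} {πs} → ListsAut G πs → length πs ≤ n ^ n
aut≤ {n} {G} {πs} aut = ≮⇒≥ λ n^n< →
  let i , j , i<j , eq = pigeonhole n^n< (λ i → funToFin (lookup πs i ⟨$⟩ʳ_)) in
  AllPairs-lookup (ListsAut.distinct aut) i<j λ v →
    trans (sym (finToFun-funToFin (lookup πs i ⟨$⟩ʳ_) v))
      (trans (cong (λ x → finToFun x v) eq) (finToFun-funToFin (lookup πs j ⟨$⟩ʳ_) v))

-- Below the threshold N the group order is at most N ^ N, a constant.
2^aut≤ : ∀ {n c N a} → 1 ≤ n → (N ≤ n → a ≤ c * ⌊log₂ n ⌋) → a ≤ n ^ n →
         2 ^ a ≤ 2 ^ (N ^ N) * n ^ c
2^aut≤ {n} {c} {N} {a} 1≤n log-aut a≤ with N ≤? n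
... | yes N≤n = begin
  2 ^ a                       ≤⟨ ^-monoʳ-≤ 2 (log-aut N≤n) ⟩
  2 ^ (c * ⌊log₂ n ⌋)         ≡⟨ cong (2 ^_) (*-comm c ⌊log₂ n ⌋) ⟩
  2 ^ (⌊log₂ n ⌋ * c)         ≡⟨ sym (^-*-assoc 2 ⌊log₂ n ⌋ c) ⟩
  (2 ^ ⌊log₂ n ⌋) ^ c         ≤⟨ ^-monoˡ-≤ c (2^log≤ n 1≤n) ⟩
  n ^ c                       ≤⟨ m≤n*m (n ^ c) (2 ^ (N ^ N)) {{m^n≢0 2 (N ^ N)}} ⟩
  2 ^ (N ^ N) * n ^ c         ∎
  where open ≤-Reasoning
... | no N≰n = begin
  2 ^ a                       ≤⟨ ^-monoʳ-≤ 2 (≤-trans a≤ (≤-trans (^-monoˡ-≤ n n≤N)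
                                   (^-monoʳ-≤ N {{>-nonZero (≤-trans 1≤n n≤N)}} n≤N))) ⟩
  2 ^ (N ^ N)                 ≤⟨ m≤m*n (2 ^ (N ^ N)) (n ^ c) {{m^n≢0 n c {{>-nonZero 1≤n}}}} ⟩
  2 ^ (N ^ N) * n ^ c         ∎
  where
  open ≤-Reasoning
  n≤N : n ≤ N
  n≤N = <⇒≤ (≰⇒> N≰n)

-- With x = n + l, the factor `a` is replaced by 2^a, at most D x^c. The three summands become x^4,
-- D² x^(2c+1) and D x^(c+2), which explains the constant; the exponent 2c + 6 covers all three with
-- room to spare.
bound≤power : ∀ {n l a c D} → 1 ≤ n → 2 ^ a ≤ D * n ^ c →
              bound n l a ≤ (1 + D * D + D) * (n + l) ^ (c + (c + 6))
bound≤power {n} {l} {a} {c} {D} 1≤n E≤ = begin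
  n ^ 2 * l ^ 2 + 2 ^ a * (n * a + n * l)
    ≤⟨ +-mono-≤ (*-mono-≤ (^-monoˡ-≤ 2 n≤x) (^-monoˡ-≤ 2 l≤x))
         (*-mono-≤ E≤′ (+-mono-≤ (*-mono-≤ n≤x (≤-trans (n≤2^n a) E≤′)) (*-mono-≤ n≤x l≤x))) ⟩
  x ^ 2 * x ^ 2 + D * y * (x * (D * y) + x * x)
    ≡⟨ regroup D x y ⟩
  1 * x ^ 4 + D * D * (y * (y * x)) + D * (y * (x * x))
    ≤⟨ unbounded (scale 1 (≤-trans x⁴≤ (≤-trans (m≤n*m (x ^ 6) y) (m≤n*m (y * x ^ 6) y)))
       ⊞ scale (D * D) (*-monoʳ-≤ y (*-monoʳ-≤ y (m≤m*n x (x ^ 5))))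
       ⊞ scale D (*-monoʳ-≤ y (≤-trans (*-monoʳ-≤ x (m≤m*n x (x ^ 4))) (m≤n*m (x ^ 6) y)))) ⟩
  (1 + D * D + D) * (y * (y * x ^ 6))
    ≡⟨ cong ((1 + D * D + D) *_) (sym (trans (^-distribˡ-+-* x c (c + 6)) (cong (y *_) (^-distribˡ-+-* x c 6)))) ⟩
  (1 + D * D + D) * x ^ (c + (c + 6)) ∎
  where
  open ≤-Reasoning
  x y : ℕ
  x = n + l
  y = x ^ c
  n≤x : n ≤ x
  n≤x = m≤m+n n l
  l≤x : l ≤ x
  l≤x = m≤n+m l n
  instance
    x≢0 : NonZero x
    x≢0 = >-nonZero (≤-trans 1≤n n≤x)
    y≢0 : NonZero y
    y≢0 = m^n≢0 x c
    x⁴≢0 : NonZero (x ^ 4)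
    x⁴≢0 = m^n≢0 x 4
    x⁵≢0 : NonZero (x ^ 5)
    x⁵≢0 = m^n≢0 x 5
  x⁴≤ : x ^ 4 ≤ x ^ 6
  x⁴≤ = ^-monoʳ-≤ x (m≤m+n 4 2)
  E≤′ : 2 ^ a ≤ D * y
  E≤′ = ≤-trans E≤ (*-monoʳ-≤ D (^-monoˡ-≤ c n≤x))
  regroup : ∀ D x y → x * (x * 1) * (x * (x * 1)) + D * y * (x * (D * y) + x * x)
            ≡ 1 * (x * (x * (x * (x * 1)))) + D * D * (y * (y * x)) + D * (y * (x * x))
  regroup = solve-∀

relax : ∀ {P s U V} {Q : State → Set} →
        ∃[ s′ ] ∃[ t ] (⟨ P , s ⟩⇓⟨ s′ , t ⟩ × Q s′ × t ≤ U) → U ≤ V →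
        ∃[ s′ ] ∃[ t ] (⟨ P , s ⟩⇓⟨ s′ , t ⟩ × Q s′ × t ≤ V)
relax (s′ , t , exec , out , t≤U) U≤V = s′ , t , exec , out , ≤-trans t≤U U≤V

theorem1 : (∃[ P ] ∃[ C ] ComputesLWithin P (λ _ → ⊤)
    (λ n k a → C * (n ^ 2 * ⌊log₂ k ⌋ ^ 2 + 2 ^ a * (n * a + n * ⌊log₂ k ⌋))))
    ×
    ((𝒢 : GraphClass) → HasLogAut 𝒢 →
    ∃[ P ] ∃[ C ] ∃[ d ] ComputesLWithin P 𝒢
    (λ n k a → C * (n + ⌊log₂ k ⌋) ^ d))
theorem1 = (program , timeConstant , computes (λ _ → ⊤)) , polynomial
  where
  polynomial : (𝒢 : GraphClass) → HasLogAut 𝒢 →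
    ∃[ P ] ∃[ C ] ∃[ d ] ComputesLWithin P 𝒢 (λ n k a → C * (n + ⌊log₂ k ⌋) ^ d)
  polynomial 𝒢 (c , N , log-aut) = program , timeConstant * (1 + D * D + D) , c + (c + 6) , within
    where
    D : ℕ
    D = 2 ^ (N ^ N)
    within : ComputesLWithin program 𝒢 (λ n k a → timeConstant * (1 + D * D + D) * (n + ⌊log₂ k ⌋) ^ (c + (c + 6)))
    within {n} G k πs 1≤n 1≤k G∈𝒢 aut = relax (computes 𝒢 G k πs 1≤n 1≤k G∈𝒢 aut) (≤-trans
      (*-monoʳ-≤ timeConstant (bound≤power {n} {⌊log₂ k ⌋} {length πs} {c} {D} 1≤n
        (2^aut≤ {n} {c} {N} {length πs} 1≤n (λ N≤n → log-aut G πs N≤n G∈𝒢 aut) (aut≤ aut))))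
      (≤-reflexive (sym (*-assoc timeConstant (1 + D * D + D) ((n + ⌊log₂ k ⌋) ^ (c + (c + 6)))))))
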